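{- Let $G$ be a finite connected graph with edge set $E$, fix an acyclic cycle signature $\sigma$ and an acyclic cocycle signature $\sigma^*$, and let $\varphi_{\sigma,\sigma^*}$ be the map from orientations to spanning subgraphs defined below. Then $$[0,1]^E=\biguplus_{\overrightarrow{O}\in\{0,1\}^E}\mathrm{hoc}\big(\overrightarrow{O},\varphi_{\sigma,\sigma^*}(\overrightarrow{O})\big),$$ i.e. the cube is the disjoint union of these half-open cells.
   Context: Fix a reference orientation of $G$ (loops, multiple edges allowed); discrete orientations are identified with $\{0,1\}^E$ and continuous orientations with $[0,1]^E$ (coordinate $1$ = oriented as reference, $0$ = opposite, strictly between = bi-oriented). For an orientation $\overrightarrow{O}\in\{0,1\}^E$ and $S\subseteq E$, $\mathrm{hoc}(\overrightarrow{O},S)$ is the set of continuous orientations in which each $e\notin S$ is oriented as in $\overrightarrow{O}$ and each $e\in S$ is oriented as in $\overrightarrow{O}$ or bi-oriented. Directed cycles/cocycles (cocycle = inclusion-minimal nonempty cut, all edges directed from one side to the other) are identified with $\{0,\pm1\}$-vectors. A cycle signature $\sigma$ picks a direction $\sigma(C)$ for each cycle; acyclic means $\sum a_C\sigma(C)=0$, $a_C\ge0$ forces $a_C=0$; an orientation is $\sigma$-compatible if each directed cycle in it is some $\sigma(C)$; similarly for cocycle signatures $\sigma^*$; $(\sigma,\sigma^*)$-compatible means both. For a spanning tree $T$, $C(T,e)$ ($e\notin T$) is the unique cycle in $T\cup\{e\}$, $C^*(T,e)$ ($e\in T$) the unique cocycle in $(E\setminus T)\cup\{e\}$; $g_{\sigma,\sigma^*}(T)$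 orients each $e\notin T$ as in $\sigma(C(T,e))$ and each $e\in T$ as in $\sigma^*(C^*(T,e))$, and is a bijection onto $(\sigma,\sigma^*)$-compatible orientations. Each orientation $\overrightarrow{O}$ is obtained from a unique $(\sigma,\sigma^*)$-compatible orientation $\overrightarrow{O^{cp}}$ by reversing pairwise disjoint directed cycles $\overrightarrow{C_i}$ ($i\in I$) and directed cocycles $\overrightarrow{C_j^*}$ ($j\in J$) in $\overrightarrow{O^{cp}}$ (the unions of the $C_i$ and of the $C^*_j$ being determined by $\overrightarrow{O}$), and $\varphi_{\sigma,\sigma^*}(\overrightarrow{O})=g_{\sigma,\sigma^*}^{ -1}(\overrightarrow{O^{cp}})\cup(\biguplus_{i}C_i)\setminus(\biguplus_jC^*_j)$.
   Formalization: The points of the cube [0,1]^E are taken with rational coordinates, and acyclicity of the signatures is required only for rational nonnegative coefficients. -}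

module Defs where

open import Data.Nat using (ℕ; zero; suc)
open import Data.Fin using (Fin; _≟_)
import Data.Fin as F
open import Data.Bool using (Bool; true; false; not; _∧_; _∨_; if_then_else_)
open import Data.Vec using (Vec; lookup; tabulate; map)
open import Data.List using (List; []; _∷_; foldr; _++_)
open import Data.List.Relation.Unary.All using (All)
open import Data.List.Relation.Unary.AllPairs using (AllPairs)
open import Data.Integer as ℤ using (ℤ)
open import Data.Rational as ℚ using (ℚ; 0ℚ; 1ℚ)
open import Data.Product using (Σ; ∃; _×_; _,_; proj₁; proj₂)
open import Data.Sum using (_⊎_)
open import Data.Unit using (⊤)
open import Relation.Nullary using (¬_; does)
open import Relation.Binary.PropositionalEquality using (_≡_; _≢_)

-- Finite graphs (loops and multiple edges allowed).
-- Vertices Fin nV, edges Fin nE; the reference orientation of edge e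
-- goes from (tail e) to (head e).

record Graph : Set where
  field
    nV nE : ℕ
    tail head : Fin nE → Fin nV

open Graph public

data Sgn : Set where
  plus minus zer : Sgn

SVec : Graph → Set
SVec G = Vec Sgn (nE G)

-- discrete orientations {0,1}^E : true = as reference, false = opposite
Ori : Graph → Set
Ori G = Vec Bool (nE G)

-- spanning subgraphs = edge subsets
ESet : Graph → Set
ESet G = Vec Bool (nE G)

VSet : Graph → Set
VSet G = Vec Bool (nV G)

-- continuous orientations: points of ℚ^E (constrained to [0,1]^E by Cube)
CtsOri : Graph → Set
CtsOri G = Fin (nE G) → ℚ

negS : Sgn → Sgn
negS plus = minus
negS minus = plus
negS zer = zer

negV : ∀ {G} → SVec G → SVec G
negV = map negS

sgnℤ : Sgn → ℤ
sgnℤ plus = ℤ.+ 1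
sgnℤ minus = ℤ.-[1+ 0 ]
sgnℤ zer = ℤ.+ 0

sgnℚ : Sgn → ℚ
sgnℚ plus = 1ℚ
sgnℚ minus = ℚ.- 1ℚ
sgnℚ zer = 0ℚ

nzB : Sgn → Bool
nzB zer = false
nzB _ = true

InSupp : ∀ {G} → SVec G → Fin (nE G) → Set
InSupp C e = lookup C e ≢ zer

NonEmpty : ∀ {G} → SVec G → Set
NonEmpty {G} C = ∃ λ e → InSupp {G} C e

SuppSub : ∀ {G} → SVec G → SVec G → Set
SuppSub {G} C D = ∀ e → InSupp {G} C e → InSupp {G} D e

Σℤ : ∀ {k} → (Fin k → ℤ) → ℤ
Σℤ {zero} f = ℤ.+ 0
Σℤ {suc k} f = f F.zero ℤ.+ Σℤ (λ i → f (F.suc i))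

ind : ∀ {k} → Fin k → Fin k → ℤ
ind u v = if does (u ≟ v) then ℤ.+ 1 else ℤ.+ 0

IsFlow : (G : Graph) → SVec G → Set
IsFlow G C = ∀ (u : Fin (nV G)) →
  Σℤ (λ e → sgnℤ (lookup C e) ℤ.* (ind (head G e) u ℤ.- ind (tail G e) u)) ≡ ℤ.+ 0

IsCycle : (G : Graph) → SVec G → Set
IsCycle G C = IsFlow G C × NonEmpty {G} C ×
  (∀ (W : SVec G) → IsFlow G W → NonEmpty {G} W → SuppSub {G} W C → SuppSub {G} C W)

cutSign : Bool → Bool → Sgn
cutSign true false = plus
cutSign false true = minus
cutSign _ _ = zer

cutVec : (G : Graph) → VSet G → SVec G
cutVec G X = tabulate (λ e → cutSign (lookup X (tail G e)) (lookup X (head G e)))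

IsCocycle : (G : Graph) → SVec G → Set
IsCocycle G D = (∃ λ (X : VSet G) → D ≡ cutVec G X) × NonEmpty {G} D ×
  (∀ (Y : VSet G) → NonEmpty {G} (cutVec G Y) → SuppSub {G} (cutVec G Y) D →
     SuppSub {G} D (cutVec G Y))

Agree : Sgn → Bool → Set
Agree plus b = b ≡ true
Agree minus b = b ≡ false
Agree zer b = ⊤

DirectedIn : ∀ {G} → SVec G → Ori G → Set
DirectedIn C O = ∀ e → Agree (lookup C e) (lookup O e)

DirCycleIn : (G : Graph) → Ori G → SVec G → Set
DirCycleIn G O C = IsCycle G C × DirectedIn {G} C O

DirCocycleIn : (G : Graph) → Ori G → SVec G → Set
DirCocycleIn G O D = IsCocycle G D × DirectedIn {G} D O

-- cycle signature: σ selects (σ C ≡ true) exactly one of C, -C for every cycle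
IsCycleSig : (G : Graph) → (SVec G → Bool) → Set
IsCycleSig G σ = ∀ C → IsCycle G C → σ C ≡ not (σ (negV {G} C))

IsCocycleSig : (G : Graph) → (SVec G → Bool) → Set
IsCocycleSig G σ = ∀ D → IsCocycle G D → σ D ≡ not (σ (negV {G} D))

combo : ∀ {G} → List (ℚ × SVec G) → Fin (nE G) → ℚ
combo L e = foldr (λ p acc → proj₁ p ℚ.* sgnℚ (lookup (proj₂ p) e) ℚ.+ acc) 0ℚ L

-- acyclic: no nontrivial nonnegative combination of selected (co)cycles is 0
-- (a family with positive coefficients summing to 0 must be empty)
AcyclicSig : (G : Graph) → (SVec G → Set) → (SVec G → Bool) → Set
AcyclicSig G IsC σ = ∀ (L : List (ℚ × SVec G)) →
  All (λ p → IsC (proj₂ p) × σ (proj₂ p) ≡ true × 0ℚ ℚ.< proj₁ p) L →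
  (∀ e → combo {G} L e ≡ 0ℚ) → L ≡ []

Compatible : (G : Graph) → (SVec G → Bool) → Ori G → Set
Compatible G σ O = ∀ C → DirCycleIn G O C → σ C ≡ true

CoCompatible : (G : Graph) → (SVec G → Bool) → Ori G → Set
CoCompatible G σ* O = ∀ D → DirCocycleIn G O D → σ* D ≡ true

data Reach (G : Graph) (P : Fin (nE G) → Set) (u : Fin (nV G)) : Fin (nV G) → Set where
  here : Reach G P u u
  fwd  : ∀ e → P e → Reach G P u (tail G e) → Reach G P u (head G e)
  bwd  : ∀ e → P e → Reach G P u (head G e) → Reach G P u (tail G e)

Connected : Graph → Set
Connected G = ∀ u v → Reach G (λ _ → ⊤) u v

_∈ₑ_ : ∀ {G} → Fin (nE G) → ESet G → Set
e ∈ₑ T = lookup T e ≡ true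

SpanningTree : (G : Graph) → ESet G → Set
SpanningTree G T = (∀ u v → Reach G (λ e → _∈ₑ_ {G} e T) u v) ×
  (∀ C → IsCycle G C → ¬ (∀ e → InSupp {G} C e → _∈ₑ_ {G} e T))

-- O = g_{σ,σ*}(T): each e ∉ T oriented as in σ(C(T,e)), each e ∈ T as in σ*(C*(T,e))
GOrient : (G : Graph) → (SVec G → Bool) → (SVec G → Bool) → ESet G → Ori G → Set
GOrient G σ σ* T O = ∀ e →
  (lookup T e ≡ false → ∃ λ C → IsCycle G C ×
     (∀ f → InSupp {G} C f → lookup T f ≡ true ⊎ f ≡ e) × InSupp {G} C e ×
     σ C ≡ true × Agree (lookup C e) (lookup O e)) ×
  (lookup T e ≡ true → ∃ λ D → IsCocycle G D ×
     (∀ f → InSupp {G} D f → lookup T f ≡ false ⊎ f ≡ e) × InSupp {G} D e ×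
     σ* D ≡ true × Agree (lookup D e) (lookup O e))

inUnion : ∀ {G} → List (SVec G) → Fin (nE G) → Bool
inUnion L e = foldr (λ C b → nzB (lookup C e) ∨ b) false L

Disjoint : ∀ {G} → SVec G → SVec G → Set
Disjoint {G} C D = ∀ e → InSupp {G} C e → ¬ InSupp {G} D e

-- φ_{σ,σ*}(O) = S, as a relation: O is obtained from the compatible
-- orientation O^cp = g(T) by reversing pairwise disjoint directed cycles Cs and
-- directed cocycles Ds of O^cp, and S = T ∪ ⋃Cs ∖ ⋃Ds.
Phi : (G : Graph) → (SVec G → Bool) → (SVec G → Bool) → Ori G → ESet G → Set
Phi G σ σ* O S = ∃ λ (T : ESet G) → SpanningTree G T × ∃ λ (Ocp : Ori G) →
  GOrient G σ σ* T Ocp × Compatible G σ Ocp × CoCompatible G σ* Ocp ×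
  ∃ λ (Cs : List (SVec G)) → ∃ λ (Ds : List (SVec G)) →
  All (DirCycleIn G Ocp) Cs × All (DirCocycleIn G Ocp) Ds ×
  AllPairs (Disjoint {G}) (Cs ++ Ds) ×
  O ≡ tabulate (λ e → if inUnion {G} (Cs ++ Ds) e then not (lookup Ocp e) else lookup Ocp e) ×
  S ≡ tabulate (λ e → (lookup T e ∨ inUnion {G} Cs e) ∧ not (inUnion {G} Ds e))

val : Bool → ℚ
val true = 1ℚ
val false = 0ℚ

Cube : (G : Graph) → CtsOri G → Set
Cube G x = ∀ e → (0ℚ ℚ.≤ x e) × (x e ℚ.≤ 1ℚ)

InHoc : (G : Graph) → Ori G → ESet G → CtsOri G → Set
InHoc G O S x = ∀ e →
  (lookup S e ≡ false → x e ≡ val (lookup O e)) ×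
  (lookup S e ≡ true → x e ≡ val (lookup O e) ⊎ (0ℚ ℚ.< x e × x e ℚ.< 1ℚ))

{-# OPTIONS --safe #-}
module Submission where

-- Write cycles and cocycles as orthogonal families of signed vectors, interchanged by
-- duality. If T yields the orientation P, then a cycle agreeing with P outside T is
-- the sum of the fundamental cycles of its edges there, so acyclicity forces it to be
-- the one selected by σ. Now let two orientations O, O′ with images X, X′ satisfy,
-- at every edge, O = O′ or X = X′. Orthogonality and the fact above show that the same
-- cycles and cocycles were reversed, and Minty's painting lemma, applied to a painting
-- built from the two trees, that the trees coincide; hence O = O′ and X = X′.
-- This gives disjointness of the cells. It also gives covering: start from orientations
-- prescribed everywhere and, for one edge after another, replace the prescribed
-- direction by the requirement that the edge lie in X; the two orientations that
-- differ in the prescribed direction differ in X at that edge, so one of them will do.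

open import Defs
open import Data.Bool using (Bool; true; false; not; _∧_; _∨_; if_then_else_)
open import Data.Bool.Properties using (not-involutive; ¬-not; not-¬)
import Data.Bool.Properties as Bool
open import Data.Empty using (⊥; ⊥-elim)
open import Data.Fin.Base using (finToFun; funToFin)
open import Data.Fin.Induction using (spo-wellFounded)
open import Data.Fin.Properties using (all?; any?; 2↔Bool; finToFun-funToFin)
open import Data.Fin using (Fin; zero; suc) renaming (_≟_ to _≟F_)
open import Data.Integer using (ℤ; 0ℤ; 1ℤ; _+_; _*_; -_; _-_; _≤_; +≤+)
import Data.Integer as ℤ
import Data.Integer.Properties as ℤ
open import Data.Integer.Tactic.RingSolver using (solve-∀)
open import Data.List using (List; []; _∷_; foldr; _++_; allFin)
open import Data.List.Membership.Propositional using (_∈_)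
open import Data.List.Membership.Propositional.Properties using (∈-allFin)
open import Data.List.Relation.Unary.Any using (here; there)
open import Data.List.Relation.Unary.All as All using (All; []; _∷_)
import Data.List.Relation.Unary.All.Properties as All
import Data.List as List
open import Data.List.Relation.Unary.AllPairs using (AllPairs; []; _∷_)
import Data.List.Relation.Unary.AllPairs.Properties as AllPairs
open import Data.Nat using (ℕ; zero; suc; z≤n; s≤s)
import Data.Nat as ℕ
import Data.Nat.Properties as ℕ
open import Data.Product using (∃; _×_; _,_; proj₁; proj₂)
open import Data.Rational using (ℚ; 0ℚ; 1ℚ; mkℚ)
import Data.Rational as ℚ
import Data.Rational.Properties as ℚ
import Data.Rational.Unnormalised as ℚᵘ
import Data.Rational.Unnormalised.Properties as ℚᵘ
open import Data.Nat.Coprimality as Coprimality using (1-coprimeTo)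
open import Data.Sum using (_⊎_; inj₁; inj₂; [_,_]′)
import Data.Sum as Sum
open import Data.Unit using (⊤; tt)
open import Data.Vec using (Vec; []; _∷_; lookup; map; tabulate; replicate; _[_]≔_)
open import Data.Vec.Properties using (lookup-map; lookup∘tabulate; lookup-replicate; lookup∘update;
  lookup∘update′; tabulate∘lookup; tabulate-cong; tabulate-∘; ≡-dec)
open import Function using (_∘_; Inverse)
open import Induction.WellFounded using (Acc; acc)
open import Relation.Binary.Structures using (IsStrictPartialOrder)
open import Relation.Nullary using (¬_; Dec; yes; no)
open import Relation.Nullary.Decidable using (map′; _×-dec_; _→-dec_; ¬?; decidable-stable; dec-true; dec-false)
open import Relation.Unary using (Decidable)
open import Relation.Binary.PropositionalEquality

-- That φ is a map is part of what is proved. A compatible orientation is reached by reversing badly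
-- directed cycles and then badly directed cocycles; acyclicity of the signatures forbids a return
-- to an earlier orientation. Its tree is found by turning directed edges one at a time into edges
-- required inside or outside the tree; when both requirements can be met, uniqueness of trees shows
-- that one of the two results has the wanted direction. The covering step is the same exchange one
-- level up. Uniqueness assumes only `O = O′` or `X = X′` at each edge so that it also yields that φ
-- is single-valued. The individual reversed cycles are not determined by an orientation, only their
-- sum is; hence reversals are compared through integer flows and a status for each edge. Before
-- graphs appear, all rests on orthogonality and Minty's lemma, which are symmetric in cycles and
-- cocycles, so a statement about cocycles is obtained from its dual.

private variable
  k n : ℕ
  A : Set

-- Finite sums

Σ-cong : {f g : Fin k → ℤ} → (∀ i → f i ≡ g i) → Σℤ f ≡ Σℤ g
Σ-cong {zero} p = refl
Σ-cong {suc k} p = cong₂ _+_ (p zero) (Σ-cong (p ∘ suc))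

Σ-zero : {f : Fin k → ℤ} → (∀ i → f i ≡ 0ℤ) → Σℤ f ≡ 0ℤ
Σ-zero {zero} p = refl
Σ-zero {suc k} p rewrite p zero = trans (ℤ.+-identityˡ _) (Σ-zero (p ∘ suc))

Σ-+ : (f g : Fin k → ℤ) → Σℤ (λ i → f i + g i) ≡ Σℤ f + Σℤ g
Σ-+ {zero} f g = refl
Σ-+ {suc k} f g rewrite Σ-+ (f ∘ suc) (g ∘ suc) = shuffle (f zero) (g zero) _ _
  where
  shuffle : ∀ a b c d → a + b + (c + d) ≡ a + c + (b + d)
  shuffle = solve-∀

Σ-*ˡ : ∀ c (f : Fin k → ℤ) → Σℤ (λ i → c * f i) ≡ c * Σℤ f
Σ-*ˡ {zero} c f = sym (ℤ.*-zeroʳ c)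
Σ-*ˡ {suc k} c f rewrite Σ-*ˡ c (f ∘ suc) = sym (ℤ.*-distribˡ-+ c (f zero) _)

Σ-swap : (f : Fin k → Fin n → ℤ) → Σℤ (λ i → Σℤ (f i)) ≡ Σℤ (λ j → Σℤ (λ i → f i j))
Σ-swap {zero} {n} f = sym (Σ-zero {n} {λ _ → 0ℤ} λ _ → refl)
Σ-swap {suc k} f =
  trans (cong (Σℤ (f zero) +_) (Σ-swap (f ∘ suc))) (sym (Σ-+ (f zero) (λ j → Σℤ (λ i → f (suc i) j))))

Σ-single : ∀ (f : Fin k → ℤ) i → (∀ j → j ≢ i → f j ≡ 0ℤ) → Σℤ f ≡ f i
Σ-single f zero p =
  trans (cong (f zero +_) (Σ-zero (λ j → p (suc j) λ ()))) (ℤ.+-identityʳ _)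
Σ-single f (suc i) p rewrite p zero (λ ()) =
  trans (ℤ.+-identityˡ _) (Σ-single (f ∘ suc) i λ j j≢i → p (suc j) λ { refl → j≢i refl })

Σ-nonneg : {f : Fin k → ℤ} → (∀ i → 0ℤ ≤ f i) → 0ℤ ≤ Σℤ f
Σ-nonneg {zero} p = ℤ.≤-refl
Σ-nonneg {suc k} p = ℤ.+-mono-≤ (p zero) (Σ-nonneg (p ∘ suc))

+-nonneg-zeroˡ : ∀ {a b} → 0ℤ ≤ a → 0ℤ ≤ b → a + b ≡ 0ℤ → a ≡ 0ℤ
+-nonneg-zeroˡ {ℤ.+ zero} {ℤ.+ b} _ _ _ = refl
+-nonneg-zeroˡ {ℤ.+ suc a} {ℤ.+ b} _ _ ()

Σ-nonneg-zero : {f : Fin k → ℤ} → (∀ i → 0ℤ ≤ f i) → Σℤ f ≡ 0ℤ → ∀ i → f i ≡ 0ℤ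
Σ-nonneg-zero {suc k} {f} p s zero = +-nonneg-zeroˡ (p zero) (Σ-nonneg (p ∘ suc)) s
Σ-nonneg-zero {suc k} {f} p s (suc i) = Σ-nonneg-zero (p ∘ suc)
  (+-nonneg-zeroˡ (Σ-nonneg (p ∘ suc)) (p zero) (trans (ℤ.+-comm _ (f zero)) s)) i

ind-refl : (i : Fin k) → ind i i ≡ 1ℤ
ind-refl i rewrite dec-true (i ≟F i) refl = refl

ind-≢ : {i j : Fin k} → i ≢ j → ind i j ≡ 0ℤ
ind-≢ {i = i} {j} i≢j rewrite dec-false (i ≟F j) i≢j = refl

Σ-ind : (f : Fin k → ℤ) (i : Fin k) → Σℤ (λ j → f j * ind i j) ≡ f i
Σ-ind f i = trans (Σ-single _ i λ j j≢i → trans (cong (f j *_) (ind-≢ (j≢i ∘ sym))) (ℤ.*-zeroʳ (f j)))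
  (trans (cong (f i *_) (ind-refl i)) (ℤ.*-identityʳ (f i)))

⟨_,_⟩ : (Fin n → ℤ) → (Fin n → ℤ) → ℤ
⟨ x , y ⟩ = Σℤ λ e → x e * y e

⟪_⟫ : Vec Sgn n → Fin n → ℤ
⟪ C ⟫ e = sgnℤ (lookup C e)

dot-comm : (x y : Fin n → ℤ) → ⟨ x , y ⟩ ≡ ⟨ y , x ⟩
dot-comm x y = Σ-cong λ e → ℤ.*-comm (x e) (y e)

dot-+ˡ : {x y z : Fin n → ℤ} (u : Fin n → ℤ) → (∀ e → z e ≡ x e + y e) →
  ⟨ z , u ⟩ ≡ ⟨ x , u ⟩ + ⟨ y , u ⟩
dot-+ˡ {x = x} {y} u p =
  trans (Σ-cong λ e → trans (cong (_* u e) (p e)) (ℤ.*-distribʳ-+ (u e) (x e) (y e)))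
    (Σ-+ (λ e → x e * u e) (λ e → y e * u e))

dot-neg : {x z : Fin n → ℤ} (u : Fin n → ℤ) → (∀ e → z e ≡ - x e) → ⟨ z , u ⟩ ≡ - ⟨ x , u ⟩
dot-neg {x = x} {z} u p = trans (Σ-cong λ e → trans (cong (_* u e) (p e)) (pull (x e) (u e)))
  (trans (Σ-*ˡ (- 1ℤ) λ e → x e * u e) (ℤ.-1*i≡-i _))
  where
  pull : ∀ a b → - a * b ≡ - 1ℤ * (a * b)
  pull = solve-∀

-- Signs and signed vectors

sgn : Bool → Sgn
sgn true = plus
sgn false = minus

sgn-nonzero : ∀ b → sgn b ≢ zer
sgn-nonzero true ()
sgn-nonzero false ()

zer? : (s : Sgn) → Dec (s ≡ zer)
zer? plus = no λ ()
zer? minus = no λ ()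
zer? zer = yes refl

Agree? : ∀ s b → Dec (Agree s b)
Agree? plus true = yes refl
Agree? plus false = no λ ()
Agree? minus true = no λ ()
Agree? minus false = yes refl
Agree? zer b = yes tt

dir : Sgn → Bool
dir plus = true
dir minus = false
dir zer = true

Agree-sgn : ∀ b → Agree (sgn b) b
Agree-sgn true = refl
Agree-sgn false = refl

Agree-dir : ∀ s → Agree s (dir s)
Agree-dir plus = refl
Agree-dir minus = refl
Agree-dir zer = tt

agree⇒sgn : ∀ {s b} → s ≢ zer → Agree s b → s ≡ sgn b
agree⇒sgn {plus} _ refl = refl
agree⇒sgn {minus} _ refl = refl
agree⇒sgn {zer} s≢0 _ = ⊥-elim (s≢0 refl)

agree-zer : ∀ {s b} → s ≡ zer → Agree s b
agree-zer refl = tt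

disagree : ∀ {s b} → ¬ Agree s b → Agree s (not b)
disagree {plus} {true} p = ⊥-elim (p refl)
disagree {plus} {false} p = refl
disagree {minus} {true} p = refl
disagree {minus} {false} p = ⊥-elim (p refl)
disagree {zer} p = tt

agree-neg : ∀ {s b} → Agree s (not b) → Agree (negS s) b
agree-neg {plus} {false} p = refl
agree-neg {minus} {true} p = refl
agree-neg {zer} p = tt

negS-zer : ∀ {s} → negS s ≡ zer → s ≡ zer
negS-zer {zer} _ = refl

sgnℤ-neg : ∀ s → sgnℤ (negS s) ≡ - sgnℤ s
sgnℤ-neg plus = refl
sgnℤ-neg minus = refl
sgnℤ-neg zer = refl

sgnℤ-zero : ∀ {s} → sgnℤ s ≡ 0ℤ → s ≡ zer
sgnℤ-zero {zer} _ = refl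

*-sgnℤ-zero : ∀ a {s} → s ≢ zer → a * sgnℤ s ≡ 0ℤ → a ≡ 0ℤ
*-sgnℤ-zero a s≢0 p = [ (λ q → q) , ⊥-elim ∘ s≢0 ∘ sgnℤ-zero ]′ (ℤ.i*j≡0⇒i≡0∨j≡0 a p)

agree-nonneg : ∀ {s t b} → Agree s b → Agree t b → 0ℤ ≤ sgnℤ s * sgnℤ t
agree-nonneg {plus} {plus} _ _ = +≤+ z≤n
agree-nonneg {plus} {minus} refl ()
agree-nonneg {plus} {zer} _ _ = +≤+ z≤n
agree-nonneg {minus} {plus} refl ()
agree-nonneg {minus} {minus} _ _ = +≤+ z≤n
agree-nonneg {minus} {zer} _ _ = +≤+ z≤n
agree-nonneg {zer} _ _ = +≤+ z≤n

neg : Vec Sgn n → Vec Sgn n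
neg = map negS

lookup-neg : (C : Vec Sgn n) (e : Fin n) → lookup (neg C) e ≡ negS (lookup C e)
lookup-neg C e = lookup-map e negS C

neg-nonzero : (C : Vec Sgn n) {e : Fin n} → lookup C e ≢ zer → lookup (neg C) e ≢ zer
neg-nonzero C {e} C≢0 p = C≢0 (negS-zer (trans (sym (lookup-neg C e)) p))

neg-nonzero⁻ : (C : Vec Sgn n) {e : Fin n} → lookup (neg C) e ≢ zer → lookup C e ≢ zer
neg-nonzero⁻ C {e} C≢0 p = C≢0 (trans (lookup-neg C e) (cong negS p))

agree-neg-lookup : (C : Vec Sgn n) {e : Fin n} {b : Bool} → Agree (lookup C e) (not b) →
  Agree (lookup (neg C) e) b
agree-neg-lookup C {e} p = subst (λ s → Agree s _) (sym (lookup-neg C e)) (agree-neg p)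

⟪neg⟫ : (C : Vec Sgn n) (e : Fin n) → ⟪ neg C ⟫ e ≡ - ⟪ C ⟫ e
⟪neg⟫ C e = trans (cong sgnℤ (lookup-neg C e)) (sgnℤ-neg (lookup C e))

sumL : List (Vec Sgn n) → Fin n → ℤ
sumL K e = foldr (λ C a → ⟪ C ⟫ e + a) 0ℤ K

sumL-++ : (K L : List (Vec Sgn n)) (e : Fin n) → sumL (K ++ L) e ≡ sumL K e + sumL L e
sumL-++ [] L e = sym (ℤ.+-identityˡ _)
sumL-++ (C ∷ K) L e =
  trans (cong (⟪ C ⟫ e +_) (sumL-++ K L e)) (sym (ℤ.+-assoc (⟪ C ⟫ e) (sumL K e) (sumL L e)))

size : Vec Sgn n → ℕ
size [] = 0
size (zer ∷ C) = size C
size (_ ∷ C) = suc (size C)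

size-mono : (C D : Vec Sgn n) → (∀ e → lookup C e ≢ zer → lookup D e ≢ zer) → size C ℕ.≤ size D
size-mono [] [] p = z≤n
size-mono (zer ∷ C) (zer ∷ D) p = size-mono C D (p ∘ suc)
size-mono (zer ∷ C) (plus ∷ D) p = ℕ.m≤n⇒m≤1+n (size-mono C D (p ∘ suc))
size-mono (zer ∷ C) (minus ∷ D) p = ℕ.m≤n⇒m≤1+n (size-mono C D (p ∘ suc))
size-mono (plus ∷ C) (zer ∷ D) p = ⊥-elim (p zero (λ ()) refl)
size-mono (minus ∷ C) (zer ∷ D) p = ⊥-elim (p zero (λ ()) refl)
size-mono (plus ∷ C) (plus ∷ D) p = s≤s (size-mono C D (p ∘ suc))
size-mono (plus ∷ C) (minus ∷ D) p = s≤s (size-mono C D (p ∘ suc))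
size-mono (minus ∷ C) (plus ∷ D) p = s≤s (size-mono C D (p ∘ suc))
size-mono (minus ∷ C) (minus ∷ D) p = s≤s (size-mono C D (p ∘ suc))

size-strict : (C D : Vec Sgn n) → (∀ e → lookup C e ≢ zer → lookup D e ≢ zer) →
  ∀ e → lookup C e ≡ zer → lookup D e ≢ zer → size C ℕ.< size D
size-strict (zer ∷ C) (plus ∷ D) p zero _ _ = s≤s (size-mono C D (p ∘ suc))
size-strict (zer ∷ C) (minus ∷ D) p zero _ _ = s≤s (size-mono C D (p ∘ suc))
size-strict (zer ∷ C) (zer ∷ D) p zero _ q = ⊥-elim (q refl)
size-strict (zer ∷ C) (zer ∷ D) p (suc e) q r = size-strict C D (p ∘ suc) e q r
size-strict (zer ∷ C) (plus ∷ D) p (suc e) q r = ℕ.m≤n⇒m≤1+n (size-strict C D (p ∘ suc) e q r)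
size-strict (zer ∷ C) (minus ∷ D) p (suc e) q r = ℕ.m≤n⇒m≤1+n (size-strict C D (p ∘ suc) e q r)
size-strict (plus ∷ C) (zer ∷ D) p (suc e) q r = ⊥-elim (p zero (λ ()) refl)
size-strict (minus ∷ C) (zer ∷ D) p (suc e) q r = ⊥-elim (p zero (λ ()) refl)
size-strict (plus ∷ C) (plus ∷ D) p (suc e) q r = s≤s (size-strict C D (p ∘ suc) e q r)
size-strict (plus ∷ C) (minus ∷ D) p (suc e) q r = s≤s (size-strict C D (p ∘ suc) e q r)
size-strict (minus ∷ C) (plus ∷ D) p (suc e) q r = s≤s (size-strict C D (p ∘ suc) e q r)
size-strict (minus ∷ C) (minus ∷ D) p (suc e) q r = s≤s (size-strict C D (p ∘ suc) e q r)

-- Finite search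

Searchable : Set → Set₁
Searchable A = {P : A → Set} → Decidable P → Dec (∃ P)

search-Bool : Searchable Bool
search-Bool P? with P? true | P? false
... | yes p | _ = yes (true , p)
... | no _ | yes p = yes (false , p)
... | no p | no q = no λ { (true , r) → p r ; (false , r) → q r }

search-Sgn : Searchable Sgn
search-Sgn P? with P? plus | P? minus | P? zer
... | yes p | _ | _ = yes (plus , p)
... | no _ | yes p | _ = yes (minus , p)
... | no _ | no _ | yes p = yes (zer , p)
... | no p | no q | no r = no λ { (plus , s) → p s ; (minus , s) → q s ; (zer , s) → r s }

search-Vec : Searchable A → Searchable (Vec A n)
search-Vec {n = zero} _ P? = map′ (λ p → [] , p) (λ { ([] , p) → p }) (P? [])
search-Vec {n = suc n} s P? =
  map′ (λ (a , v , p) → a ∷ v , p) (λ { (a ∷ v , p) → a , v , p })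
    (s λ a → search-Vec s λ v → P? (a ∷ v))

either-all : {P Q : Fin k → Set} → (∀ i → P i ⊎ Q i) → (∃ P) ⊎ (∀ i → Q i)
either-all {zero} _ = inj₂ λ ()
either-all {suc k} d with d zero | either-all (d ∘ suc)
... | inj₁ p | _ = inj₁ (zero , p)
... | inj₂ _ | inj₁ (i , p) = inj₁ (suc i , p)
... | inj₂ q | inj₂ qs = inj₂ λ { zero → q ; (suc i) → qs i }

-- Paintings and dual pairs of families of signed vectors

data Paint : Set where
  one : Bool → Paint
  bi none : Paint

flip : Paint → Paint
flip (one b) = one b
flip bi = none
flip none = bi

flip-involutive : ∀ p → flip (flip p) ≡ p
flip-involutive (one b) = refl
flip-involutive bi = refl
flip-involutive none = refl

Permits : Paint → Sgn → Set
Permits (one b) s = Agree s b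
Permits bi s = ⊤
Permits none s = s ≡ zer

Permits? : ∀ p s → Dec (Permits p s)
Permits? (one b) s = Agree? s b
Permits? bi s = yes tt
Permits? none s = zer? s

permits-zer : ∀ q → Permits q zer
permits-zer (one b) = tt
permits-zer bi = tt
permits-zer none = refl

Conforms : (Fin n → Paint) → Vec Sgn n → Set
Conforms F C = ∀ e → Permits (F e) (lookup C e)

-- This is why `flip` fixes directed edges: a flow conforming to `F` and a cut conforming to
-- `flip ∘ F` have no negative product at any edge, so orthogonality makes every product zero.
permits-nonneg : ∀ p {s t} → Permits p s → Permits (flip p) t → 0ℤ ≤ sgnℤ s * sgnℤ t
permits-nonneg (one b) p q = agree-nonneg p q
permits-nonneg bi {s} p refl = ℤ.≤-reflexive (sym (ℤ.*-zeroʳ (sgnℤ s)))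
permits-nonneg none refl q = +≤+ z≤n

Through : (Vec Sgn n → Set) → (Fin n → Paint) → Fin n → Set
Through P F e = ∃ λ C → P C × lookup C e ≢ zer × Conforms F C

-- The last field is Minty's painting lemma: bi edges may be used by a flow in
-- either direction and none edges not at all, and vice versa for cuts.
record Pair (n : ℕ) : Set₁ where
  field
    Flw Cut : Vec Sgn n → Set
    orth : ∀ {C D} → Flw C → Cut D → ⟨ ⟪ C ⟫ , ⟪ D ⟫ ⟩ ≡ 0ℤ
    minty : ∀ F e {b} → F e ≡ one b → Through Flw F e ⊎ Through Cut (flip ∘ F) e

swapPair : Pair n → Pair n
swapPair p = record
  { Flw = Cut
  ; Cut = Flw
  ; orth = λ {C} {D} c d → trans (dot-comm ⟪ C ⟫ ⟪ D ⟫) (orth d c)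
  ; minty = λ F e p → [ inj₂ , inj₁ ∘ back F ]′ (minty (flip ∘ F) e (cong flip p))
  }
  where
  open Pair p
  back : ∀ F {e} → Through Cut (flip ∘ flip ∘ F) e → Through Cut F e
  back F (C , c , C≢0 , conf) =
    C , c , C≢0 , λ f → subst (λ q → Permits q _) (flip-involutive (F f)) (conf f)

-- Support-minimal vectors and Minty's lemma for them

Elementary : (Vec Sgn n → Set) → Vec Sgn n → Set
Elementary P C = P C × (∃ λ e → lookup C e ≢ zer) ×
  (∀ V → P V → (∃ λ e → lookup V e ≢ zer) → (∀ e → lookup V e ≢ zer → lookup C e ≢ zer) →
    ∀ e → lookup C e ≢ zer → lookup V e ≢ zer)

_⊑_ : Vec Sgn n → Vec Sgn n → Set
C ⊑ W = ∀ e → lookup C e ≢ zer → lookup C e ≡ lookup W e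

⊑-trans : {U V W : Vec Sgn n} → U ⊑ V → V ⊑ W → U ⊑ W
⊑-trans p q e U≢0 = trans (p e U≢0) (q e λ V≡0 → U≢0 (trans (p e U≢0) V≡0))

⊑-supp : {C W : Vec Sgn n} → C ⊑ W → ∀ e → lookup C e ≢ zer → lookup W e ≢ zer
⊑-supp p e C≢0 W≡0 = C≢0 (trans (p e C≢0) W≡0)

⊑-permits : ∀ {C W : Vec Sgn n} {F} → C ⊑ W → Conforms F W → Conforms F C
⊑-permits {C = C} {W} {F} p conf e with zer? (lookup C e)
... | no C≢0 = subst (Permits (F e)) (sym (p e C≢0)) (conf e)
... | yes C≡0 = subst (Permits (F e)) (sym C≡0) (permits-zer (F e))

upd : (Fin n → A) → Fin n → A → Fin n → A
upd F e a f with f ≟F e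
... | yes _ = a
... | no _ = F f

upd-same : ∀ (F : Fin n → A) e a → upd F e a e ≡ a
upd-same F e a with e ≟F e
... | yes _ = refl
... | no e≢e = ⊥-elim (e≢e refl)

upd-other : ∀ (F : Fin n → A) {e a f} → f ≢ e → upd F e a f ≡ F f
upd-other F {e} {a} {f} f≢e with f ≟F e
... | yes f≡e = ⊥-elim (f≢e f≡e)
... | no _ = refl

*-nonzero : ∀ {a b} → a ≢ 0ℤ → b ≢ 0ℤ → a * b ≢ 0ℤ
*-nonzero {a} a≢0 b≢0 p = [ a≢0 , b≢0 ]′ (ℤ.i*j≡0⇒i≡0∨j≡0 a p)

sgnℤ-nonzero : ∀ {s} → s ≢ zer → sgnℤ s ≢ 0ℤ
sgnℤ-nonzero s≢0 = s≢0 ∘ sgnℤ-zero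

module Refine (p : Pair n) where
  open Pair p

  along : Vec Sgn n → Fin n → Paint
  along W f with zer? (lookup W f)
  ... | yes _ = none
  ... | no _ = one (dir (lookup W f))

  along-nonzero : ∀ W {f} → lookup W f ≢ zer → along W f ≡ one (dir (lookup W f))
  along-nonzero W {f} p with zer? (lookup W f)
  ... | yes q = ⊥-elim (p q)
  ... | no _ = refl

  along-conforms : ∀ W {f s} → Permits (along W f) s → s ≢ zer → s ≡ lookup W f
  along-conforms W {f} q s≢0 with zer? (lookup W f)
  ... | yes _ = ⊥-elim (s≢0 q)
  ... | no W≢0 = trans (agree⇒sgn s≢0 q) (sym (agree⇒sgn W≢0 (Agree-dir (lookup W f))))

  -- A cut that meets the support of `W` exactly in `e` and `f`. Orthogonal to it, a flow supported
  -- in `W` vanishes at both of these edges or at neither.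
  Pivot : Vec Sgn n → Fin n → Fin n → Set
  Pivot W e f = ∃ λ D → Cut D × lookup D e ≢ zer × lookup D f ≢ zer ×
    ∀ g → g ≢ e → g ≢ f → lookup W g ≢ zer → lookup D g ≡ zer

  -- Each term of the inner product other than those at e and f is nonnegative
  -- and the one at e is 1, so the one at f is -1 and the others vanish.
  pivot : ∀ W {e f D} → f ≢ e → Flw W → Cut D → lookup W e ≢ zer → lookup D e ≢ zer →
    Conforms (flip ∘ upd (along W) f none) D → Pivot W e f
  pivot W {e} {f} {D} f≢e w d We≢0 De≢0 conf = D , d , De≢0 , Df≢0 , off
    where
    prod : Fin n → ℤ
    prod g = ⟪ W ⟫ g * ⟪ D ⟫ g

    -- The two corrections cancel in the sum and make every term nonnegative: the product at `e` is
    -- 1, and the one at `f` is at least -1. A zero sum then determines all terms at once.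
    shifted : Fin n → ℤ
    shifted g = prod g + ind f g + - ind e g

    agree-D : ∀ {g} → lookup W g ≢ zer → g ≢ f → Agree (lookup D g) (dir (lookup W g))
    agree-D {g} Wg≢0 g≢f = subst (λ q → Permits (flip q) (lookup D g))
      (trans (upd-other (along W) g≢f) (along-nonzero W Wg≢0)) (conf g)

    prod-nonneg : ∀ {g} → g ≢ f → 0ℤ ≤ prod g
    prod-nonneg {g} g≢f with zer? (lookup W g)
    ... | yes p = subst (λ s → 0ℤ ≤ sgnℤ s * ⟪ D ⟫ g) (sym p) (+≤+ z≤n)
    ... | no p = agree-nonneg (Agree-dir (lookup W g)) (agree-D p g≢f)

    square : ∀ {s} → s ≢ zer → sgnℤ s * sgnℤ s ≡ 1ℤ
    square {plus} _ = refl
    square {minus} _ = refl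
    square {zer} p = ⊥-elim (p refl)

    prod-e : prod e ≡ 1ℤ
    prod-e = trans (cong (λ s → ⟪ W ⟫ e * sgnℤ s)
      (trans (agree⇒sgn De≢0 (agree-D We≢0 (f≢e ∘ sym)))
        (sym (agree⇒sgn We≢0 (Agree-dir (lookup W e)))))) (square We≢0)

    bounded : ∀ s t → 0ℤ ≤ sgnℤ s * sgnℤ t + 1ℤ + - 0ℤ
    bounded plus plus = +≤+ z≤n
    bounded plus minus = +≤+ z≤n
    bounded plus zer = +≤+ z≤n
    bounded minus plus = +≤+ z≤n
    bounded minus minus = +≤+ z≤n
    bounded minus zer = +≤+ z≤n
    bounded zer t = +≤+ z≤n

    simplify : ∀ a → a + 0ℤ + - 0ℤ ≡ a
    simplify = solve-∀

    shifted-e : shifted e ≡ 0ℤ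
    shifted-e rewrite prod-e | ind-refl e | ind-≢ f≢e = refl

    shifted-other : ∀ {g} → g ≢ e → g ≢ f → shifted g ≡ prod g
    shifted-other {g} g≢e g≢f rewrite ind-≢ (g≢e ∘ sym) | ind-≢ (g≢f ∘ sym) = simplify (prod g)

    shifted-f : shifted f ≡ prod f + 1ℤ + - 0ℤ
    shifted-f rewrite ind-refl f | ind-≢ (f≢e ∘ sym) = refl

    shifted-nonneg : ∀ g → 0ℤ ≤ shifted g
    shifted-nonneg g with g ≟F e | g ≟F f
    ... | yes refl | _ = ℤ.≤-reflexive (sym shifted-e)
    ... | no _ | yes refl = subst (0ℤ ≤_) (sym shifted-f) (bounded (lookup W f) (lookup D f))
    ... | no g≢e | no g≢f = subst (0ℤ ≤_) (sym (shifted-other g≢e g≢f)) (prod-nonneg g≢f)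

    Σ-ind-1 : ∀ i → Σℤ (ind {n} i) ≡ 1ℤ
    Σ-ind-1 i = trans (Σ-cong λ j → sym (ℤ.*-identityˡ (ind i j))) (Σ-ind (λ _ → 1ℤ) i)

    Σ-neg-ind : Σℤ (λ g → - ind e g) ≡ - 1ℤ
    Σ-neg-ind = trans (Σ-cong λ g → sym (ℤ.-1*i≡-i (ind e g)))
      (trans (Σ-*ˡ (- 1ℤ) (ind e)) (cong (- 1ℤ *_) (Σ-ind-1 e)))

    Σ-shifted : Σℤ shifted ≡ 0ℤ
    Σ-shifted = trans (Σ-+ (λ g → prod g + ind f g) (λ g → - ind e g))
      (cong₂ _+_ (trans (Σ-+ prod (ind f)) (cong₂ _+_ (orth w d) (Σ-ind-1 f))) Σ-neg-ind)

    vanish : ∀ g → shifted g ≡ 0ℤ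
    vanish = Σ-nonneg-zero shifted-nonneg Σ-shifted

    Df≢0 : lookup D f ≢ zer
    Df≢0 p with trans (sym (vanish f)) (trans shifted-f (cong (λ a → a + 1ℤ + - 0ℤ)
      (trans (cong (λ s → ⟪ W ⟫ f * sgnℤ s) p) (ℤ.*-zeroʳ (⟪ W ⟫ f)))))
    ... | ()

    off : ∀ g → g ≢ e → g ≢ f → lookup W g ≢ zer → lookup D g ≡ zer
    off g g≢e g≢f Wg≢0 with zer? (lookup D g)
    ... | yes p = p
    ... | no Dg≢0 = ⊥-elim (*-nonzero (sgnℤ-nonzero Wg≢0) (sgnℤ-nonzero Dg≢0)
      (trans (sym (shifted-other g≢e g≢f)) (vanish g)))

  -- A nonzero flow `V` inside `W` is nonzero at some `h`. The pivot for `h` carries this over to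
  -- `e`, and the pivot for any `f` carries it from `e` to `f`.
  pivots⇒elementary : ∀ W e → Flw W → lookup W e ≢ zer →
    (∀ f → lookup W f ≢ zer → f ≢ e → Pivot W e f) → Elementary Flw W
  pivots⇒elementary W e w We≢0 piv = w , (e , We≢0) , minimal
    where
    minimal : ∀ V → Flw V → (∃ λ f → lookup V f ≢ zer) →
      (∀ f → lookup V f ≢ zer → lookup W f ≢ zer) → ∀ f → lookup W f ≢ zer → lookup V f ≢ zer
    minimal V v (h , Vh≢0) V⊆W = all
      where
      product-zero : ∀ {f g D} → (∀ g′ → g′ ≢ f → g′ ≢ g → lookup W g′ ≢ zer → lookup D g′ ≡ zer) →
        lookup V f ≡ zer → ∀ i → i ≢ g → ⟪ V ⟫ i * ⟪ D ⟫ i ≡ 0ℤ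
      product-zero {f} {g} {D} off Vf≡0 i i≢g with zer? (lookup V i)
      ... | yes Vi≡0 = cong (λ s → sgnℤ s * ⟪ D ⟫ i) Vi≡0
      ... | no Vi≢0 = trans (cong (λ s → ⟪ V ⟫ i * sgnℤ s) (off i (λ { refl → Vi≢0 Vf≡0 }) i≢g (V⊆W i Vi≢0)))
        (ℤ.*-zeroʳ (⟪ V ⟫ i))

      Ve≢0 : lookup V e ≢ zer
      Ve≢0 Ve≡0 with piv h (V⊆W h Vh≢0) (λ { refl → Vh≢0 Ve≡0 })
      ... | D , d , De≢0 , Dh≢0 , off = *-nonzero (sgnℤ-nonzero Vh≢0) (sgnℤ-nonzero Dh≢0)
        (trans (sym (Σ-single _ h (product-zero {e} {h} {D} off Ve≡0))) (orth v d))

      all : ∀ f → lookup W f ≢ zer → lookup V f ≢ zer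
      all f Wf≢0 Vf≡0 with f ≟F e
      ... | yes refl = Ve≢0 Vf≡0
      ... | no f≢e with piv f Wf≢0 f≢e
      ... | D , d , De≢0 , Df≢0 , off = *-nonzero (sgnℤ-nonzero Ve≢0) (sgnℤ-nonzero De≢0)
        (trans (sym (Σ-single _ e (product-zero {f} {e} {D} (λ g g≢f g≢e → off g g≢e g≢f) Vf≡0))) (orth v d))

  Smaller : Vec Sgn n → Fin n → Set
  Smaller W e = ∃ λ V → Flw V × lookup V e ≢ zer × V ⊑ W × size V ℕ.< size W

  -- Minty's lemma for the painting that allows only the directions of `W` and forbids `f`: a flow
  -- loses `f` from its support, while a cut is a pivot for `f`.
  shrink-or-pivot : ∀ W e → Flw W → lookup W e ≢ zer → ∀ f →
    Smaller W e ⊎ (lookup W f ≢ zer → f ≢ e → Pivot W e f)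
  shrink-or-pivot W e w We≢0 f with zer? (lookup W f) | f ≟F e
  ... | yes Wf≡0 | _ = inj₂ λ Wf≢0 → ⊥-elim (Wf≢0 Wf≡0)
  ... | no _ | yes f≡e = inj₂ λ _ f≢e → ⊥-elim (f≢e f≡e)
  ... | no Wf≢0 | no f≢e with minty (upd (along W) f none) e
          (trans (upd-other (along W) (f≢e ∘ sym)) (along-nonzero W We≢0))
  ... | inj₂ (D , d , De≢0 , conf) = inj₂ λ _ _ → pivot W f≢e w d We≢0 De≢0 conf
  ... | inj₁ (V , v , Ve≢0 , conf) =
    inj₁ (V , v , Ve≢0 , V⊑W , size-strict V W (⊑-supp {C = V} {W} V⊑W) f Vf≡0 Wf≢0)
    where
    Vf≡0 : lookup V f ≡ zer
    Vf≡0 = subst (λ q → Permits q (lookup V f)) (upd-same (along W) f none) (conf f)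
    V⊑W : V ⊑ W
    V⊑W g Vg≢0 = along-conforms W (subst (λ q → Permits q (lookup V g))
      (upd-other (along W) λ { refl → Vg≢0 Vf≡0 }) (conf g)) Vg≢0

  refine : ∀ m W e → size W ℕ.≤ m → Flw W → lookup W e ≢ zer →
    ∃ λ C → Elementary Flw C × lookup C e ≢ zer × C ⊑ W
  refine m W e W≤m w We≢0 with either-all (shrink-or-pivot W e w We≢0)
  ... | inj₂ piv = W , pivots⇒elementary W e w We≢0 piv , We≢0 , λ _ _ → refl
  refine zero W e W≤m w We≢0 | inj₁ (_ , V , _ , _ , _ , V<W) with ℕ.≤-trans V<W W≤m
  ... | ()
  refine (suc m) W e W≤m w We≢0 | inj₁ (_ , V , v , Ve≢0 , V⊑W , V<W)
    with refine m V e (ℕ.s≤s⁻¹ (ℕ.≤-trans V<W W≤m)) v Ve≢0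
  ... | C , c , Ce≢0 , C⊑V = C , c , Ce≢0 , ⊑-trans {U = C} {V} {W} C⊑V V⊑W

  refine-through : ∀ F {e} → Through Flw F e → Through (Elementary Flw) F e
  refine-through F {e} (W , w , We≢0 , conf) with refine (size W) W e ℕ.≤-refl w We≢0
  ... | C , c , Ce≢0 , C⊑W = C , c , Ce≢0 , ⊑-permits {C = C} {W} {F} C⊑W conf

elementary : Pair n → Pair n
elementary p = record
  { Flw = Elementary Flw
  ; Cut = Elementary Cut
  ; orth = λ c d → orth (proj₁ c) (proj₁ d)
  ; minty = λ F e q → Sum.map (Refine.refine-through p F) (Refine.refine-through (swapPair p) (flip ∘ F)) (minty F e q)
  }
  where open Pair p

-- Systems of cycles and cocycles with acyclic signatures

record Sys (n : ℕ) : Set₁ where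
  field
    pair : Pair n
  open Pair pair public renaming (Flw to Cyc; Cut to Coc)
  field
    cyc? : Decidable Cyc
    coc? : Decidable Coc
    neg-cyc : ∀ {C} → Cyc C → Cyc (neg C)
    neg-coc : ∀ {D} → Coc D → Coc (neg D)
    s s* : Vec Sgn n → Bool
    sig : ∀ C → Cyc C → s C ≡ not (s (neg C))
    sig* : ∀ D → Coc D → s* D ≡ not (s* (neg D))
    acyclic : ∀ K → All (λ C → Cyc C × s C ≡ true) K → (∀ e → sumL K e ≡ 0ℤ) → K ≡ []
    acyclic* : ∀ K → All (λ D → Coc D × s* D ≡ true) K → (∀ e → sumL K e ≡ 0ℤ) → K ≡ []

dual : Sys n → Sys n
dual S = record
  { pair = swapPair pair
  ; cyc? = coc?
  ; coc? = cyc?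
  ; neg-cyc = neg-coc
  ; neg-coc = neg-cyc
  ; s = s*
  ; s* = s
  ; sig = sig*
  ; sig* = sig
  ; acyclic = acyclic*
  ; acyclic* = acyclic
  }
  where open Sys S

-- Integer vectors, because sums and differences of cycles leave the signed vectors. Orthogonality
-- to cocycles, instead of a boundary condition at vertices, lets the notion be dualized.
record Flow (S : Sys n) (x : Fin n → ℤ) : Set where
  constructor flow
  field pairing : ∀ D → Sys.Coc S D → ⟨ x , ⟪ D ⟫ ⟩ ≡ 0ℤ
open Flow

GoodCircuit : Sys n → (Fin n → Bool) → Bool → (Fin n → Bool) → Fin n → Set
GoodCircuit S T o P e = ∃ λ C → Sys.Cyc S C × (∀ f → lookup C f ≢ zer → T f ≡ not o ⊎ f ≡ e) ×
  lookup C e ≢ zer × Sys.s S C ≡ true × Agree (lookup C e) (P e)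

-- o is the value by which T marks the edges outside the basis; it is false for a
-- system and true for its dual, where the complement of the basis is the basis.
FundAt : Sys n → Bool → (Fin n → Bool) → (Fin n → Bool) → Set
FundAt S o T P = ∀ e → T e ≡ o → GoodCircuit S T o P e

module _ (S : Sys n) where
  open Sys S

  flow-cycle : ∀ {C} → Cyc C → Flow S ⟪ C ⟫
  flow-cycle c = flow λ D d → orth c d

  flow-cong : ∀ {x y} → (∀ e → x e ≡ y e) → Flow S x → Flow S y
  flow-cong p fx = flow λ D d → trans (Σ-cong λ e → cong (_* ⟪ D ⟫ e) (sym (p e))) (pairing fx D d)

  flow-zero : ∀ {x} → (∀ e → x e ≡ 0ℤ) → Flow S x
  flow-zero p = flow λ D d → Σ-zero λ e → cong (_* ⟪ D ⟫ e) (p e)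

  flow-+ : ∀ {x y z} → (∀ e → z e ≡ x e + y e) → Flow S x → Flow S y → Flow S z
  flow-+ {x} {y} p fx fy = flow λ D d → trans (dot-+ˡ {x = x} {y} ⟪ D ⟫ p) (cong₂ _+_ (pairing fx D d) (pairing fy D d))

  flow-neg : ∀ {x z} → (∀ e → z e ≡ - x e) → Flow S x → Flow S z
  flow-neg {x} p fx = flow λ D d → trans (dot-neg {x = x} ⟪ D ⟫ p) (cong -_ (pairing fx D d))

  flow-sumL : ∀ {K} → All (λ C → Cyc C × s C ≡ true) K → Flow S (sumL K)
  flow-sumL [] = flow-zero λ _ → refl
  flow-sumL ((c , _) ∷ cs) = flow-+ (λ _ → refl) (flow-cycle c) (flow-sumL cs)

  negated : ∀ {C} → Cyc C → s C ≡ true → s (neg C) ≡ true → ⊥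
  negated {C} c p q with trans (sym p) (trans (sig C c) (cong not q))
  ... | ()

  s-neg : ∀ {C} → Cyc C → s C ≡ false → s (neg C) ≡ true
  s-neg {C} c p = trans (sym (not-involutive _)) (cong not (trans (sym (sig C c)) p))

  -- A flow vanishing outside the basis vanishes: pair it with fundamental cocycles.
  flow-vanishes : ∀ {o T P x} → FundAt (dual S) (not o) T P → Flow S x →
    (∀ e → T e ≡ o → x e ≡ 0ℤ) → ∀ e → x e ≡ 0ℤ
  flow-vanishes {o} {T} {P} {x} fund* fx off e with T e Bool.≟ o
  ... | yes p = off e p
  ... | no p with fund* e (¬-not p)
  ... | D , d , supp , De≢0 , _ = *-sgnℤ-zero (x e) De≢0 (trans (sym (Σ-single _ e other)) (pairing fx D d))
    where
    other : ∀ f → f ≢ e → x f * ⟪ D ⟫ f ≡ 0ℤ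
    other f f≢e with zer? (lookup D f)
    ... | yes Df≡0 = trans (cong (λ t → x f * sgnℤ t) Df≡0) (ℤ.*-zeroʳ (x f))
    ... | no Df≢0 with supp f Df≢0
    ... | inj₁ q = cong (_* ⟪ D ⟫ f) (off f (trans q (not-involutive o)))
    ... | inj₂ q = ⊥-elim (f≢e q)

  -- A cycle that agrees with P outside the basis is the sum of the fundamental
  -- cycles of its edges there, so acyclicity excludes its negative.
  agree-outside⇒good : ∀ {o T P C} → FundAt S o T P → FundAt (dual S) (not o) T P → Cyc C →
    (∀ e → T e ≡ o → Agree (lookup C e) (P e)) → s C ≡ true
  agree-outside⇒good {o} {T} {P} {C} fund fund* c agree with s C in sC
  ... | true = refl
  ... | false with acyclic (neg C ∷ K) ((neg-cyc c , s-neg c sC) ∷ K-good) balanced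
    where
    Good : List (Vec Sgn n) → Set
    Good = All (λ C → Cyc C × s C ≡ true)

    pick : ∀ e → ∃ λ L → Good L × (∀ g → T g ≡ o → sumL L g ≡ ⟪ C ⟫ e * ind g e)
    pick e with T e Bool.≟ o
    ... | no Te≢o = [] , [] , λ g Tg≡o → sym (trans (cong (⟪ C ⟫ e *_)
            (ind-≢ {i = g} {e} λ { refl → Te≢o Tg≡o })) (ℤ.*-zeroʳ (⟪ C ⟫ e)))
    ... | yes Te≡o with zer? (lookup C e)
    ... | yes Ce≡0 = [] , [] , λ g _ → sym (cong (λ t → sgnℤ t * ind g e) Ce≡0)
    ... | no Ce≢0 with fund e Te≡o
    ... | B , b , supp , Be≢0 , sB , agr = B ∷ [] , (b , sB) ∷ [] , value
      where
      value : ∀ g → T g ≡ o → ⟪ B ⟫ g + 0ℤ ≡ ⟪ C ⟫ e * ind g e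
      value g Tg≡o with g ≟F e
      -- The fundamental cycle `B` and `C` both agree with `P` at this edge, hence have the same
      -- sign, so `B` enters with coefficient 1.
      ... | yes refl = trans (ℤ.+-identityʳ _) (trans (cong sgnℤ (trans (agree⇒sgn Be≢0 agr)
              (sym (agree⇒sgn Ce≢0 (agree g Te≡o))))) (sym (ℤ.*-identityʳ (⟪ C ⟫ g))))
      ... | no g≢e = trans (ℤ.+-identityʳ _) (trans Bg≡0 (sym (ℤ.*-zeroʳ (⟪ C ⟫ e))))
        where
        Bg≡0 : ⟪ B ⟫ g ≡ 0ℤ
        Bg≡0 with zer? (lookup B g)
        ... | yes p = cong sgnℤ p
        ... | no p with supp g p
        ... | inj₁ q = ⊥-elim (not-¬ {o} refl (trans (sym Tg≡o) q))
        ... | inj₂ q = ⊥-elim (g≢e q)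

    gather : (Fin k → List (Vec Sgn n)) → List (Vec Sgn n)
    gather {zero} L = []
    gather {suc k} L = L zero ++ gather (L ∘ suc)

    gather-good : {L : Fin k → List (Vec Sgn n)} → (∀ i → Good (L i)) → Good (gather L)
    gather-good {zero} p = []
    gather-good {suc k} p = All.++⁺ (p zero) (gather-good (p ∘ suc))

    gather-sum : (L : Fin k → List (Vec Sgn n)) → ∀ g → sumL (gather L) g ≡ Σℤ λ i → sumL (L i) g
    gather-sum {zero} L g = refl
    gather-sum {suc k} L g = trans (sumL-++ (L zero) _ g) (cong (sumL (L zero) g +_) (gather-sum (L ∘ suc) g))

    K : List (Vec Sgn n)
    K = gather (proj₁ ∘ pick)

    K-good : Good K
    K-good = gather-good λ e → proj₁ (proj₂ (pick e))

    outside : ∀ g → T g ≡ o → sumL (neg C ∷ K) g ≡ 0ℤ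
    outside g Tg≡o = trans (cong₂ _+_ (⟪neg⟫ C g) (trans (gather-sum (proj₁ ∘ pick) g)
      (trans (Σ-cong λ e → proj₂ (proj₂ (pick e)) g Tg≡o) (Σ-ind ⟪ C ⟫ g)))) (ℤ.+-inverseˡ (⟪ C ⟫ g))

    balanced : ∀ e → sumL (neg C ∷ K) e ≡ 0ℤ
    balanced = flow-vanishes {o} {T} {P} fund*
      (flow-+ (λ _ → refl) (flow-cycle (neg-cyc c)) (flow-sumL K-good)) outside
  ... | ()

paint : ℤ → Paint
paint (ℤ.+ zero) = none
paint (ℤ.+ suc _) = one true
paint (ℤ.-[1+ _ ]) = one false

paint-one : ∀ {a} → a ≢ 0ℤ → ∃ λ b → paint a ≡ one b
paint-one {ℤ.+ zero} p = ⊥-elim (p refl)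
paint-one {ℤ.+ suc _} p = true , refl
paint-one {ℤ.-[1+ _ ]} p = false , refl

paint-nonneg : ∀ a {s} → Permits (flip (paint a)) s → 0ℤ ≤ a * sgnℤ s
paint-nonneg (ℤ.+ zero) p = +≤+ z≤n
paint-nonneg (ℤ.+ suc a) {plus} p = +≤+ z≤n
paint-nonneg (ℤ.+ suc a) {zer} p = ℤ.≤-reflexive (sym (ℤ.*-zeroʳ (ℤ.+ suc a)))
paint-nonneg (ℤ.-[1+ a ]) {minus} p = +≤+ z≤n
paint-nonneg (ℤ.-[1+ a ]) {zer} p = ℤ.≤-reflexive (sym (ℤ.*-zeroʳ ℤ.-[1+ a ]))

-- The other alternative of Minty's lemma is a cocycle whose products with `x` are all nonnegative
-- and nonzero at `e`, which contradicts orthogonality.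
conformal-cycle : (S : Sys n) {x : Fin n → ℤ} → Flow S x → ∀ e → x e ≢ 0ℤ →
  Through (Sys.Cyc S) (paint ∘ x) e
conformal-cycle S {x} fx e xe≢0 with Sys.minty S (paint ∘ x) e (proj₂ (paint-one xe≢0))
... | inj₁ t = t
... | inj₂ (D , d , De≢0 , conf) =
  ⊥-elim (xe≢0 (*-sgnℤ-zero (x e) De≢0 (Σ-nonneg-zero (λ f → paint-nonneg (x f) (conf f)) (pairing fx D d) e)))

-- Uniqueness: how two reversal data can compare

-- Whether an edge of the compatible orientation is kept, or reversed as part of a
-- directed cycle or of a directed cocycle.
data Status : Set where
  keep cyc coc : Status

exchange : Status → Status
exchange keep = keep
exchange cyc = coc
exchange coc = cyc

exchange-involutive : ∀ t → exchange (exchange t) ≡ t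
exchange-involutive keep = refl
exchange-involutive cyc = refl
exchange-involutive coc = refl

reversed : Bool → Status → Bool
reversed p keep = p
reversed p cyc = not p
reversed p coc = not p

-- Membership in the image under φ when `o` is `false`: edges of reversed cycles are added, edges of
-- reversed cocycles removed. The parameter `o` lets the dual use the same formula.
updated : Bool → Bool → Status → Bool
updated o t keep = t
updated o t cyc = not o
updated o t coc = o

cycVal : Bool → Status → ℤ
cycVal p keep = 0ℤ
cycVal p cyc = sgnℤ (sgn p)
cycVal p coc = 0ℤ

-- What uniqueness needs of a reversal: the families of cycles and cocycles are forgotten, and only
-- their sums are recorded, as flows read off from `P` and the status.
record Datum (S : Sys n) (o : Bool) (T P : Fin n → Bool) (st : Fin n → Status) : Set where
  field
    fund : FundAt S o T P
    fund* : FundAt (dual S) (not o) T P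
    cyc-flow : Flow S (λ e → cycVal (P e) (st e))
    coc-flow : Flow (dual S) (λ e → cycVal (P e) (exchange (st e)))

dual-datum : ∀ {S : Sys n} {o T P st} → Datum S o T P st → Datum (dual S) (not o) T P (exchange ∘ st)
dual-datum {S = S} {o} {T} {P} {st} δ = record
  { fund = fund*
  ; fund* = subst (λ o → FundAt S o T P) (sym (not-involutive o)) fund
  ; cyc-flow = coc-flow
  ; coc-flow = flow λ D d → pairing (flow-cong S
      (λ e → cong (cycVal (P e)) (sym (exchange-involutive (st e)))) cyc-flow) D d
  }
  where open Datum δ

Match : Bool → (p p′ t t′ : Bool) → Status → Status → Set
Match o p p′ t t′ u u′ = reversed p u ≡ reversed p′ u′ ⊎ updated o t u ≡ updated o t′ u′

match-sym : ∀ {o p p′ t t′ u u′} → Match o p p′ t t′ u u′ → Match o p′ p t′ t u′ u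
match-sym = Sum.map sym sym

not≢ : ∀ {b} → b ≡ not b → ⊥
not≢ {true} ()
not≢ {false} ()

dual-match : ∀ {o p p′ t t′} u u′ → Match o p p′ t t′ u u′ →
  Match (not o) p p′ t t′ (exchange u) (exchange u′)
dual-match u u′ = Sum.map
  (λ q → trans (sym (rev u)) (trans q (rev u′))) (λ q → trans (sym (upd′ u)) (trans q (upd′ u′)))
  where
  rev : ∀ {p} u → reversed p u ≡ reversed p (exchange u)
  rev keep = refl
  rev cyc = refl
  rev coc = refl
  upd′ : ∀ {o t} u → updated o t u ≡ updated (not o) t (exchange u)
  upd′ keep = refl
  upd′ cyc = refl
  upd′ {o} coc = sym (not-involutive o)

-- The decisive case has a cycle edge on one side and a cocycle edge on the other. The updated
-- values are then `not o` and `o`, so the match must be one of orientations; as both sides are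
-- reversed there, `p ≡ p′`.
cross-nonneg : ∀ {o p p′ t t′} u u′ {c} → Match o p p′ t t′ u u′ → Permits (paint (cycVal p u)) c →
  0ℤ ≤ cycVal p′ (exchange u′) * sgnℤ c
cross-nonneg u keep m q = +≤+ z≤n
cross-nonneg u cyc m q = +≤+ z≤n
cross-nonneg {p′ = p′} keep coc m refl = ℤ.≤-reflexive (sym (ℤ.*-zeroʳ (sgnℤ (sgn p′))))
cross-nonneg {p′ = p′} coc coc m refl = ℤ.≤-reflexive (sym (ℤ.*-zeroʳ (sgnℤ (sgn p′))))
cross-nonneg cyc coc (inj₂ m) q = ⊥-elim (not≢ (sym m))
cross-nonneg {p = true} {true} cyc coc (inj₁ m) q = agree-nonneg {plus} {b = true} refl q
cross-nonneg {p = false} {false} cyc coc (inj₁ m) q = agree-nonneg {minus} {b = false} refl q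

Apart : Status → Status → Set
Apart u u′ = ¬ (u ≡ cyc × u′ ≡ coc)

diff : (p p′ : Bool) → Status → Status → ℤ
diff p p′ u u′ = cycVal p u - cycVal p′ u′

-- The decisive case is `keep` against `cyc`: outside the first basis the updated values are `o` and
-- `not o`, so the orientations match and `p` is opposite to `p′`. Subtracting the second cycle flow
-- therefore points along `p`.
agree-first : ∀ {o p p′ t t′} u u′ {c} → Match o p p′ t t′ u u′ → Apart u u′ → Apart u′ u →
  Permits (paint (diff p p′ u u′)) c → t ≡ o → Agree c p
agree-first keep keep _ _ _ refl _ = tt
agree-first keep coc _ _ _ refl _ = tt
agree-first coc keep _ _ _ refl _ = tt
agree-first coc coc _ _ _ refl _ = tt
agree-first cyc coc _ a _ _ _ = ⊥-elim (a (refl , refl))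
agree-first coc cyc _ _ a _ _ = ⊥-elim (a (refl , refl))
agree-first {p = true} cyc keep _ _ _ q _ = q
agree-first {p = false} cyc keep _ _ _ q _ = q
agree-first {p = true} {true} cyc cyc _ _ _ refl _ = tt
agree-first {p = true} {false} cyc cyc _ _ _ q _ = q
agree-first {p = false} {true} cyc cyc _ _ _ q _ = q
agree-first {p = false} {false} cyc cyc _ _ _ refl _ = tt
agree-first keep cyc (inj₂ m) _ _ _ refl = ⊥-elim (not≢ m)
agree-first {p = true} {false} keep cyc (inj₁ m) _ _ q _ = q
agree-first {p = false} {true} keep cyc (inj₁ m) _ _ q _ = q

paint-neg : ∀ {a b c} → b ≡ - a → Permits (paint a) c → Permits (paint b) (negS c)
paint-neg {ℤ.+ zero} refl refl = refl
paint-neg {ℤ.+ suc _} {c = plus} refl q = refl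
paint-neg {ℤ.+ suc _} {c = zer} refl q = tt
paint-neg {ℤ.-[1+ _ ]} {c = minus} refl q = refl
paint-neg {ℤ.-[1+ _ ]} {c = zer} refl q = tt

module Compare (S : Sys n) (o : Bool) {T T′ P P′ : Fin n → Bool} {st st′ : Fin n → Status} where
  open Sys S

  Matched : Set
  Matched = ∀ e → Match o (P e) (P′ e) (T e) (T′ e) (st e) (st′ e)

  -- Where they meet, a reversed directed cycle and a reversed directed cocycle
  -- would be parallel, contradicting orthogonality.
  apart : Datum S o T P st → Datum S o T′ P′ st′ → Matched → ∀ e → Apart (st e) (st′ e)
  apart δ δ′ m e (u , u′) with conformal-cycle S (Datum.cyc-flow δ) e
      (λ q → sgnℤ-nonzero (sgn-nonzero (P e)) (trans (cong (cycVal (P e)) (sym u)) q))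
  ... | C , c , Ce≢0 , conf = sgnℤ-nonzero (sgn-nonzero (P′ e)) (trans (cong (λ v → cycVal (P′ e) (exchange v)) (sym u′))
      (*-sgnℤ-zero _ Ce≢0 (Σ-nonneg-zero (λ f → cross-nonneg (st f) (st′ f) (m f) (conf f))
        (pairing (Datum.coc-flow δ′) C c) e)))

  -- A cycle conforming to the difference of the two flows would agree with `P` outside `T`, and its
  -- negative with `P′` outside `T′`, so the signature would select both.
  cycles-equal : Datum S o T P st → Datum S o T′ P′ st′ → Matched →
    (∀ e → Apart (st e) (st′ e)) → (∀ e → Apart (st′ e) (st e)) →
    ∀ e → cycVal (P e) (st e) ≡ cycVal (P′ e) (st′ e)
  cycles-equal δ δ′ m a a′ e with diff (P e) (P′ e) (st e) (st′ e) ℤ.≟ 0ℤ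
  ... | yes q = ℤ.i-j≡0⇒i≡j _ _ q
  ... | no q with conformal-cycle S (flow-+ S (λ _ → refl) (Datum.cyc-flow δ)
                    (flow-neg S (λ _ → refl) (Datum.cyc-flow δ′))) e q
  ... | C , c , _ , conf = ⊥-elim (negated S c
        (agree-outside⇒good S (Datum.fund δ) (Datum.fund* δ) c λ f → agree-first (st f) (st′ f) (m f) (a f) (a′ f) (conf f))
        (agree-outside⇒good S (Datum.fund δ′) (Datum.fund* δ′) (neg-cyc c) λ f →
          agree-first (st′ f) (st f) (match-sym {u = st f} {st′ f} (m f)) (a′ f) (a f)
            (subst (Permits (paint (diff (P′ f) (P f) (st′ f) (st f)))) (sym (lookup-neg C f))
              (paint-neg (antisym f) (conf f)))))
    where
    swap-diff : ∀ x y → y - x ≡ - (x - y)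
    swap-diff = solve-∀
    antisym : ∀ f → diff (P′ f) (P f) (st′ f) (st f) ≡ - diff (P f) (P′ f) (st f) (st′ f)
    antisym f = swap-diff (cycVal (P f) (st f)) _

-- Edges in both bases are bi, edges in neither are none, except where the
-- orientations differ; the other edges are directed so that every conforming cycle
-- agrees with the first orientation outside the first basis while its negative
-- agrees with the second one outside the second, and dually for cocycles.
mixed : (t t′ p p′ : Bool) → Paint
mixed false true p p′ = one p
mixed true false p p′ = one (not p′)
mixed false false true true = none
mixed false false false false = none
mixed false false true false = one true
mixed false false false true = one false
mixed true true true true = bi
mixed true true false false = bi
mixed true true true false = one false
mixed true true false true = one true

mixed-first : ∀ t t′ p p′ {c} → Permits (mixed t t′ p p′) c → t ≡ false → Agree c p
mixed-first false true p p′ q _ = q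
mixed-first false false true true refl _ = tt
mixed-first false false false false refl _ = tt
mixed-first false false true false q _ = q
mixed-first false false false true q _ = q
mixed-first true t′ p p′ q ()

mixed-second : ∀ t t′ p p′ {c} → Permits (mixed t t′ p p′) c → t′ ≡ false → Agree c (not p′)
mixed-second true false p p′ q _ = q
mixed-second false false true true refl _ = tt
mixed-second false false false false refl _ = tt
mixed-second false false true false q _ = q
mixed-second false false false true q _ = q
mixed-second true true p p′ q ()
mixed-second false true p p′ q ()

-- The hypothesis of uniqueness enters here: on an edge of only one basis the orientations coincide,
-- so a painting chosen to suit cycles suits cocycles as well.
mixed-first* : ∀ t t′ p p′ {c} → p ≡ p′ ⊎ t ≡ t′ → Permits (flip (mixed t t′ p p′)) c →
  t ≡ true → Agree c (not p)
mixed-first* true false p p′ (inj₁ refl) q _ = q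
mixed-first* true true true true _ refl _ = tt
mixed-first* true true false false _ refl _ = tt
mixed-first* true true true false _ q _ = q
mixed-first* true true false true _ q _ = q
mixed-first* false t′ p p′ _ q ()

mixed-second* : ∀ t t′ p p′ {c} → p ≡ p′ ⊎ t ≡ t′ → Permits (flip (mixed t t′ p p′)) c →
  t′ ≡ true → Agree c p′
mixed-second* false true p p′ (inj₁ refl) q _ = q
mixed-second* true true true true _ refl _ = tt
mixed-second* true true false false _ refl _ = tt
mixed-second* true true true false _ q _ = q
mixed-second* true true false true _ q _ = q
mixed-second* true false p p′ _ q ()
mixed-second* false false p p′ _ q ()

undirected⇒equal : ∀ t t′ p p′ → (∀ b → mixed t t′ p p′ ≢ one b) → p ≡ p′ × t ≡ t′
undirected⇒equal false true p p′ h = ⊥-elim (h p refl)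
undirected⇒equal true false p p′ h = ⊥-elim (h (not p′) refl)
undirected⇒equal false false true true h = refl , refl
undirected⇒equal false false false false h = refl , refl
undirected⇒equal false false true false h = ⊥-elim (h true refl)
undirected⇒equal false false false true h = ⊥-elim (h false refl)
undirected⇒equal true true true true h = refl , refl
undirected⇒equal true true false false h = refl , refl
undirected⇒equal true true true false h = ⊥-elim (h false refl)
undirected⇒equal true true false true h = ⊥-elim (h true refl)

Fund : Sys n → (T P : Fin n → Bool) → Set
Fund S T P = FundAt S false T P × FundAt (dual S) true T P

-- By Minty's lemma a directed edge of the painting `mixed` would lie on a cycle or cocycle selected
-- together with its negative. So no edge is directed, and undirected edges occur only where both
-- bases and both orientations agree.
fund-unique : ∀ (S : Sys n) {T T′ P P′} → Fund S T P → Fund S T′ P′ →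
  (∀ e → P e ≡ P′ e ⊎ T e ≡ T′ e) → ∀ e → P e ≡ P′ e × T e ≡ T′ e
fund-unique {n} S {T} {T′} {P} {P′} (φ , ψ) (φ′ , ψ′) h e = undirected⇒equal _ _ _ _ undirected
  where
  open Sys S
  F : Fin n → Paint
  F f = mixed (T f) (T′ f) (P f) (P′ f)

  undirected : ∀ b → F e ≢ one b
  undirected b q with minty F e q
  ... | inj₁ (C , c , _ , conf) = negated S c
    (agree-outside⇒good S φ ψ c λ f → mixed-first (T f) (T′ f) (P f) (P′ f) (conf f))
    (agree-outside⇒good S φ′ ψ′ (neg-cyc c) λ f →
      agree-neg-lookup C ∘ mixed-second (T f) (T′ f) (P f) (P′ f) (conf f))
  -- The two data trade places: `D` agrees with `P′` on `T′`, and its negative with `P` on `T`.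
  ... | inj₂ (D , d , _ , conf) = negated (dual S) d
    (agree-outside⇒good (dual S) ψ′ φ′ d λ f → mixed-second* (T f) (T′ f) (P f) (P′ f) (h f) (conf f))
    (agree-outside⇒good (dual S) ψ φ (neg-coc d) λ f →
      agree-neg-lookup D ∘ mixed-first* (T f) (T′ f) (P f) (P′ f) (h f) (conf f))

-- A cycle value is nonzero exactly at status `cyc`, and its exchanged version exactly at `coc`, so
-- the two sums determine the status; on reversed edges they determine the direction too.
kept-match : ∀ {o p p′ t t′} u u′ → Match o p p′ t t′ u u′ →
  cycVal p u ≡ cycVal p′ u′ → cycVal p (exchange u) ≡ cycVal p′ (exchange u′) →
  u ≡ u′ × (p ≡ p′ ⊎ t ≡ t′)
kept-match keep keep m _ _ = refl , m
kept-match {p = true} {true} cyc cyc _ _ _ = refl , inj₁ refl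
kept-match {p = false} {false} cyc cyc _ _ _ = refl , inj₁ refl
kept-match {p = true} {true} coc coc _ _ _ = refl , inj₁ refl
kept-match {p = false} {false} coc coc _ _ _ = refl , inj₁ refl
kept-match {p = true} cyc keep _ () _
kept-match {p = false} cyc keep _ () _
kept-match {p = true} cyc coc _ () _
kept-match {p = false} cyc coc _ () _
kept-match {p = true} coc keep _ _ ()
kept-match {p = false} coc keep _ _ ()
kept-match {p = true} coc cyc _ _ ()
kept-match {p = false} coc cyc _ _ ()
kept-match {p′ = true} keep cyc _ () _
kept-match {p′ = false} keep cyc _ () _
kept-match {p′ = true} keep coc _ _ ()
kept-match {p′ = false} keep coc _ _ ()

datum-unique : ∀ (S : Sys n) {T T′ P P′ st st′} →
  Datum S false T P st → Datum S false T′ P′ st′ →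
  (∀ e → Match false (P e) (P′ e) (T e) (T′ e) (st e) (st′ e)) →
  ∀ e → reversed (P e) (st e) ≡ reversed (P′ e) (st′ e) ×
        updated false (T e) (st e) ≡ updated false (T′ e) (st′ e)
datum-unique S {T} {T′} {P} {P′} {st} {st′} δ δ′ m e =
  cong₂ reversed P≡P′ st≡st′ , cong₂ (updated false) T≡T′ st≡st′
  where
  δ* = dual-datum δ
  δ′* = dual-datum δ′
  m* = λ f → dual-match {p = P f} {P′ f} {T f} {T′ f} (st f) (st′ f) (m f)
  a = Compare.apart S false δ δ′ m
  a′ = Compare.apart S false δ′ δ λ f → match-sym {u = st f} {st′ f} (m f)
  undo : ∀ {u v} → Apart u v → Apart (exchange v) (exchange u)
  undo {cyc} {coc} q _ = q (refl , refl)
  undo {keep} {keep} q ()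
  undo {keep} {coc} q ()
  undo {coc} {coc} q ()
  undo {coc} {keep} q ()
  undo {coc} {cyc} q ()
  same = Compare.cycles-equal S false δ δ′ m a a′
  same* = Compare.cycles-equal (dual S) true δ* δ′* m* (λ f → undo (a′ f)) (λ f → undo (a f))
  kept = λ f → kept-match {p = P f} {P′ f} {T f} {T′ f} (st f) (st′ f) (m f) (same f) (same* f)
  bases = fund-unique S (Datum.fund δ , Datum.fund* δ) (Datum.fund δ′ , Datum.fund* δ′)
    (proj₂ ∘ kept)
  P≡P′ = proj₁ (bases e)
  T≡T′ = proj₂ (bases e)
  st≡st′ = proj₁ (kept e)

-- Every compatible orientation comes from a basis

GoodC : Sys n → (Fin n → Paint) → Set
GoodC S F = ∀ C → Sys.Cyc S C → Conforms F C → Sys.s S C ≡ true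

Bad : Sys n → (Fin n → Paint) → Set
Bad S F = ∃ λ C → Sys.Cyc S C × Conforms F C × Sys.s S C ≡ false

conforms? : (F : Fin n → Paint) → Decidable (Conforms F)
conforms? F C = all? λ e → Permits? (F e) (lookup C e)

good? : (S : Sys n) (F : Fin n → Paint) → GoodC S F ⊎ Bad S F
good? S F with search-Vec search-Sgn (λ C → Sys.cyc? S C ×-dec conforms? F C ×-dec (Sys.s S C Bool.≟ false))
... | yes (C , c , conf , q) = inj₂ (C , c , conf , q)
... | no h = inj₁ λ C c conf → ¬-not λ q → h (C , c , conf , q)

-- A painting read as a mixed prescription: a directed edge fixes the orientation and leaves the
-- basis open, an undirected one does the opposite. Two bases fitting the same painting thus satisfy
-- the hypothesis of `fund-unique`.
Fits : Paint → (t p : Bool) → Set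
Fits (one b) t p = p ≡ b
Fits bi t p = t ≡ true
Fits none t p = t ≡ false

fits-common : ∀ q {t p t′ p′} → Fits q t p → Fits q t′ p′ → p ≡ p′ ⊎ t ≡ t′
fits-common (one b) refl refl = inj₁ refl
fits-common bi refl refl = inj₂ refl
fits-common none refl refl = inj₂ refl

permits-outside : ∀ q {t p c} → Fits q t p → Permits q c → t ≡ false → Agree c p
permits-outside (one b) refl r _ = r
permits-outside bi refl r ()
permits-outside none _ refl _ = tt

permits-inside : ∀ q {t p c} → Fits q t p → Permits (flip q) c → t ≡ true → Agree c p
permits-inside (one b) refl r _ = r
permits-inside bi _ refl _ = tt
permits-inside none refl r ()

record Basis (S : Sys n) (F : Fin n → Paint) : Set where
  field
    T P : Fin n → Bool
    fund : Fund S T P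
    fits : ∀ e → Fits (F e) (T e) (P e)

module Steps (S : Sys n) (F : Fin n → Paint) (e : Fin n) {b : Bool} (Fe : F e ≡ one b) where
  open Sys S

  -- The function `h` is the identity for cycles and `flip` for cocycles.
  restore : ∀ (h : Paint → Paint) {q C} → h (one b) ≡ one b → Conforms (h ∘ upd F e q) C →
    Agree (lookup C e) b → Conforms (h ∘ F) C
  restore h {q} {C} hb conf a f with f ≟F e
  ... | yes refl = subst (λ r → Permits r _) (sym (trans (cong h Fe) hb)) a
  ... | no f≢e = subst (λ r → Permits (h r) _) (upd-other F f≢e) (conf f)

  still-good : ∀ (S′ : Sys n) (h : Paint → Paint) {q} → h (one b) ≡ one b → h q ≡ none →
    GoodC S′ (h ∘ F) → GoodC S′ (h ∘ upd F e q)
  still-good S′ h {q} hb hq good C c conf = good C c (restore h {C = C} hb conf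
    (agree-zer (subst (λ r → Permits r _) (trans (cong h (upd-same F e q)) hq) (conf e))))

  bad-direction : ∀ (S′ : Sys n) (h : Paint → Paint) {q} → h (one b) ≡ one b → GoodC S′ (h ∘ F) →
    ((C , _) : Bad S′ (h ∘ upd F e q)) → lookup C e ≢ zer × Agree (lookup C e) (not b)
  bad-direction S′ h hb good (C , c , conf , sC) = (wrong ∘ agree-zer) , disagree wrong
    where
    wrong : ¬ Agree (lookup C e) b
    wrong a with trans (sym sC) (good C c (restore h {C = C} hb conf a))
    ... | ()

  -- As `F` itself is good, the bad cycle and the bad cocycle must both use `e` against `b`. Their
  -- product is nonzero there and nonnegative elsewhere, contrary to orthogonality.
  not-both-bad : GoodC S F → GoodC (dual S) (flip ∘ F) →
    Bad S (upd F e bi) → Bad (dual S) (flip ∘ upd F e none) → ⊥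
  not-both-bad g g* (C , c , conf , sC) (D , d , conf* , sD)
    with bad-direction S (λ q → q) refl g (C , c , conf , sC) | bad-direction (dual S) flip refl g* (D , d , conf* , sD)
  ... | Ce≢0 , a | De≢0 , a* = *-nonzero (sgnℤ-nonzero Ce≢0) (sgnℤ-nonzero De≢0)
    (Σ-nonneg-zero nonneg (orth c d) e)
    where
    nonneg : ∀ f → 0ℤ ≤ ⟪ C ⟫ f * ⟪ D ⟫ f
    nonneg f with f ≟F e
    ... | yes refl = agree-nonneg a a*
    ... | no f≢e = permits-nonneg (F f)
      (subst (λ r → Permits r _) (upd-other F f≢e) (conf f))
      (subst (λ r → Permits (flip r) _) (upd-other F f≢e) (conf* f))

  lift : ∀ {q} (B : Basis S (upd F e q)) → Basis.P B e ≡ b → Basis S F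
  lift {q} B Pe = record { T = T ; P = P ; fund = fund ; fits = λ f → fits′ f }
    where
    open Basis B
    fits′ : ∀ f → Fits (F f) (T f) (P f)
    fits′ f with f ≟F e
    ... | yes refl = subst (λ r → Fits r _ _) (sym Fe) Pe
    ... | no f≢e = subst (λ r → Fits r _ _) (upd-other F f≢e) (fits f)

  -- A bad cycle for the bi painting is excluded by a basis fitting the none
  -- painting but orienting e against b: it would agree with it outside the basis.
  bad-cycle-absurd : GoodC S F → Bad S (upd F e bi) → (B : Basis S (upd F e none)) →
    Basis.P B e ≡ not b → ⊥
  bad-cycle-absurd g (C , c , conf , sC) B Pe
    with trans (sym sC) (agree-outside⇒good S (proj₁ fund) (proj₂ fund) c agree)
    where
    open Basis B
    agree : ∀ f → T f ≡ false → Agree (lookup C f) (P f)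
    agree f Tf with f ≟F e
    ... | yes refl = subst (Agree _) (sym Pe) (proj₂ (bad-direction S (λ q → q) refl g (C , c , conf , sC)))
    ... | no f≢e = permits-outside (F f) (subst (λ r → Fits r _ _) (upd-other F f≢e) (fits f))
      (subst (λ r → Permits r _) (upd-other F f≢e) (conf f)) Tf
  ... | ()

  bad-cocycle-absurd : GoodC (dual S) (flip ∘ F) → Bad (dual S) (flip ∘ upd F e none) →
    (B : Basis S (upd F e bi)) → Basis.P B e ≡ not b → ⊥
  bad-cocycle-absurd g (D , d , conf , sD) B Pe
    with trans (sym sD) (agree-outside⇒good (dual S) (proj₂ fund) (proj₁ fund) d agree)
    where
    open Basis B
    agree : ∀ f → T f ≡ true → Agree (lookup D f) (P f)
    agree f Tf with f ≟F e
    ... | yes refl = subst (Agree _) (sym Pe) (proj₂ (bad-direction (dual S) flip refl g (D , d , conf , sD)))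
    ... | no f≢e = permits-inside (F f) (subst (λ r → Fits r _ _) (upd-other F f≢e) (fits f))
      (subst (λ r → Permits (flip r) _) (upd-other F f≢e) (conf f)) Tf
  ... | ()

  -- The two bases would satisfy the hypothesis of `fund-unique`, by orientation at `e` and by
  -- fitting `F` elsewhere, yet one contains `e` and the other does not.
  both-absurd : (B : Basis S (upd F e bi)) (B′ : Basis S (upd F e none)) →
    Basis.P B e ≡ not b → Basis.P B′ e ≡ not b → ⊥
  both-absurd B B′ Pe P′e
    with trans (sym (fit-e bi B))
      (trans (proj₂ (fund-unique S (Basis.fund B) (Basis.fund B′) common e)) (fit-e none B′))
    where
    fit-e : ∀ q (B : Basis S (upd F e q)) → Fits q (Basis.T B e) (Basis.P B e)
    fit-e q B = subst (λ r → Fits r _ _) (upd-same F e q) (Basis.fits B e)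
    fit-f : ∀ q (B : Basis S (upd F e q)) {f} → f ≢ e → Fits (F f) (Basis.T B f) (Basis.P B f)
    fit-f q B f≢e = subst (λ r → Fits r _ _) (upd-other F f≢e) (Basis.fits B _)
    common : ∀ f → Basis.P B f ≡ Basis.P B′ f ⊎ Basis.T B f ≡ Basis.T B′ f
    common f with f ≟F e
    ... | yes refl = inj₁ (trans Pe (sym P′e))
    ... | no f≢e = fits-common (F f) (fit-f bi B f≢e) (fit-f none B′ f≢e)
  ... | ()

-- Without directed edges, cocycles through a none edge come in good pairs, which
-- is absurd, so there is a cycle through it.
fundamental-cycle : (S : Sys n) {F : Fin n → Paint} → (∀ e b → F e ≢ one b) →
  GoodC (dual S) (flip ∘ F) → ∀ e → F e ≡ none →
  ∃ λ C → Sys.Cyc S C × (∀ f → lookup C f ≢ zer → F f ≡ bi ⊎ f ≡ e) × lookup C e ≢ zer × Sys.s S C ≡ true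
-- Minty's lemma asks for a directed edge. Either direction serves, since the signature afterwards
-- chooses between the cycle and its negative.
fundamental-cycle S {F} undirected g* e Fe with Sys.minty S (upd F e (one true)) e (upd-same F e (one true))
... | inj₂ (D , d , _ , conf) = ⊥-elim (negated (dual S) d (g* D d λ f → proj₁ (both f))
        (g* (neg D) (Sys.neg-coc S d) λ f → proj₂ (both f)))
  where
  both : ∀ f → Permits (flip (F f)) (lookup D f) × Permits (flip (F f)) (lookup (neg D) f)
  both f with F f in q
  ... | one b = ⊥-elim (undirected f b q)
  ... | none = tt , tt
  ... | bi = D≡0 , trans (lookup-neg D f) (cong negS D≡0)
    where
    f≢e : f ≢ e
    f≢e refl with trans (sym q) Fe
    ... | ()
    D≡0 : lookup D f ≡ zer
    D≡0 = subst (λ r → Permits (flip r) (lookup D f)) (trans (upd-other F f≢e) q) (conf f)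
... | inj₁ (C , c , Ce≢0 , conf) = choose (Sys.s S C) refl
  where
  supp : ∀ f → lookup C f ≢ zer → F f ≡ bi ⊎ f ≡ e
  supp f Cf≢0 with f ≟F e | F f in q
  ... | yes f≡e | _ = inj₂ f≡e
  ... | no f≢e | one b = ⊥-elim (undirected f b q)
  ... | no f≢e | bi = inj₁ refl
  ... | no f≢e | none = ⊥-elim (Cf≢0 (subst (λ r → Permits r (lookup C f)) (trans (upd-other F f≢e) q) (conf f)))

  choose : ∀ b → Sys.s S C ≡ b → ∃ λ C → Sys.Cyc S C × (∀ f → lookup C f ≢ zer → F f ≡ bi ⊎ f ≡ e) ×
    lookup C e ≢ zer × Sys.s S C ≡ true
  choose true sC = C , c , supp , Ce≢0 , sC
  choose false sC = neg C , Sys.neg-cyc S c , (λ f → supp f ∘ neg-nonzero⁻ C) , neg-nonzero C Ce≢0 , s-neg S c sC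

basis-undirected : (S : Sys n) {F : Fin n → Paint} → (∀ e b → F e ≢ one b) →
  GoodC S F → GoodC (dual S) (flip ∘ F) → Basis S F
basis-undirected {n} S {F} undirected g g* = record
  { T = T
  ; P = P
  ; fund = outside , inside
  ; fits = λ e → fits (P e) e
  }
  where
  isBi : Paint → Bool
  isBi bi = true
  isBi (one _) = false
  isBi none = false

  T : Fin n → Bool
  T = isBi ∘ F

  T-true : ∀ {e} → T e ≡ true → F e ≡ bi
  T-true {e} p with F e
  ... | bi = refl

  T-false : ∀ {e} → T e ≡ false → F e ≡ none
  T-false {e} p with F e in q
  ... | one b = ⊥-elim (undirected e b q)
  ... | none = refl

  cycle : ∀ e → F e ≡ none → _
  cycle = fundamental-cycle S undirected g*

  cocycle : ∀ e → flip (F e) ≡ none → _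
  cocycle = fundamental-cycle (dual S) {flip ∘ F} (λ e b → undirected e b ∘ flip-one) λ C c conf →
    g C c λ f → subst (λ q → Permits q _) (flip-involutive (F f)) (conf f)
    where
    flip-one : ∀ {q b} → flip q ≡ one b → q ≡ one b
    flip-one {one _} p = p

  fits : ∀ p e → Fits (F e) (T e) p
  fits p e with F e in q
  ... | one b = ⊥-elim (undirected e b q)
  ... | bi = refl
  ... | none = refl

  at : ∀ e q → F e ≡ q → ∃ λ p →
    (T e ≡ false → GoodCircuit S T false (λ _ → p) e) × (T e ≡ true → GoodCircuit (dual S) T true (λ _ → p) e)
  at e (one b) q = ⊥-elim (undirected e b q)
  at e none q with cycle e q
  ... | C , c , supp , Ce≢0 , sC = dir (lookup C e) ,
    (λ _ → C , c , (λ f → Sum.map₁ (cong isBi) ∘ supp f) , Ce≢0 , sC , Agree-dir (lookup C e)) ,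
    λ Te → ⊥-elim (bi≢none (trans (sym (T-true Te)) q))
    where
    bi≢none : bi ≢ none
    bi≢none ()
  at e bi q with cocycle e (cong flip q)
  ... | D , d , supp , De≢0 , sD = dir (lookup D e) ,
    (λ Te → ⊥-elim (bi≢none (trans (sym q) (T-false Te)))) ,
    λ _ → D , d , (λ f → Sum.map₁ (from-flip f) ∘ supp f) , De≢0 , sD , Agree-dir (lookup D e)
    where
    bi≢none : bi ≢ none
    bi≢none ()
    from-flip : ∀ f → flip (F f) ≡ bi → T f ≡ false
    from-flip f p with F f
    ... | none = refl

  P : Fin n → Bool
  P e = proj₁ (at e (F e) refl)

  outside : FundAt S false T P
  outside e = proj₁ (proj₂ (at e (F e) refl))

  inside : FundAt (dual S) true T P
  inside e = proj₂ (proj₂ (at e (F e) refl))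

-- Induction on the directed edges, in the manner of contraction (`bi`) and deletion (`none`). At
-- most one of the two new paintings is bad. If one is, its bad vector forces the basis for the
-- other to orient `e` by `b`; if neither is, the two bases cannot both orient `e` against `b`.
basis-within : (S : Sys n) (L : List (Fin n)) (F : Fin n → Paint) → (∀ e b → F e ≡ one b → e ∈ L) →
  GoodC S F → GoodC (dual S) (flip ∘ F) → Basis S F
basis-within S [] F within g g* = basis-undirected S (λ e b q → none-in (within e b q)) g g*
  where
  none-in : ∀ {e} → ¬ (e ∈ [])
  none-in ()
basis-within {n} S (e ∷ L) F within g g* = go (F e) refl
  where
  undirect : ∀ q → (∀ b → q ≢ one b) → ∀ f b → upd F e q f ≡ one b → f ∈ L
  undirect q undirected f b p with f ≟F e
  ... | yes refl = ⊥-elim (undirected b p)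
  ... | no f≢e with within f b p
  ... | here f≡e = ⊥-elim (f≢e f≡e)
  ... | there f∈L = f∈L

  skip : (∀ b → F e ≢ one b) → Basis S F
  skip undirected = basis-within S L F within′ g g*
    where
    within′ : ∀ f b → F f ≡ one b → f ∈ L
    within′ f b p with within f b p
    ... | here refl = ⊥-elim (undirected b p)
    ... | there f∈L = f∈L

  go : ∀ q → F e ≡ q → Basis S F
  go bi Fe = skip λ b p → case-absurd (trans (sym Fe) p)
    where
    case-absurd : ∀ {b} → bi ≢ one b
    case-absurd ()
  go none Fe = skip λ b p → case-absurd (trans (sym Fe) p)
    where
    case-absurd : ∀ {b} → none ≢ one b
    case-absurd ()
  go (one b) Fe = decide (good? S (upd F e bi)) (good? (dual S) (flip ∘ upd F e none))
    where
    open Steps S F e Fe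

    with-bi : GoodC S (upd F e bi) → Basis S (upd F e bi)
    with-bi gb = basis-within S L _ (undirect bi λ _ ()) gb
      (still-good (dual S) flip refl refl g*)

    with-none : GoodC (dual S) (flip ∘ upd F e none) → Basis S (upd F e none)
    with-none gn = basis-within S L _ (undirect none λ _ ())
      (still-good S (λ q → q) refl refl g) gn

    decide : GoodC S (upd F e bi) ⊎ Bad S (upd F e bi) →
      GoodC (dual S) (flip ∘ upd F e none) ⊎ Bad (dual S) (flip ∘ upd F e none) → Basis S F
    decide (inj₂ bad) (inj₂ bad*) = ⊥-elim (not-both-bad g g* bad bad*)
    decide (inj₁ gb) (inj₂ bad*) with Basis.P (with-bi gb) e Bool.≟ b
    ... | yes p = lift (with-bi gb) p
    ... | no p = ⊥-elim (bad-cocycle-absurd g* bad* (with-bi gb) (¬-not p))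
    decide (inj₂ bad) (inj₁ gn) with Basis.P (with-none gn) e Bool.≟ b
    ... | yes p = lift (with-none gn) p
    ... | no p = ⊥-elim (bad-cycle-absurd g bad (with-none gn) (¬-not p))
    decide (inj₁ gb) (inj₁ gn) with Basis.P (with-bi gb) e Bool.≟ b | Basis.P (with-none gn) e Bool.≟ b
    ... | yes p | _ = lift (with-bi gb) p
    ... | no _ | yes p = lift (with-none gn) p
    ... | no p | no p′ = ⊥-elim (both-absurd (with-bi gb) (with-none gn) (¬-not p) (¬-not p′))

compatible-basis : (S : Sys n) (P : Fin n → Bool) → GoodC S (one ∘ P) → GoodC (dual S) (one ∘ P) →
  ∃ λ T → Fund S T P
compatible-basis {n} S P g g* = T , fund-cong
  where
  B = basis-within S (allFin n) (one ∘ P) (λ e _ _ → ∈-allFin e) g g*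
  open Basis B renaming (P to P′)
  fund-cong : Fund S T P
  fund-cong = (λ e Te → subst (λ p → GoodCircuit S T false (λ _ → p) e) (fits e) (proj₁ fund e Te)) ,
    (λ e Te → subst (λ p → GoodCircuit (dual S) T true (λ _ → p) e) (fits e) (proj₂ fund e Te))

-- Every orientation is a reversal of a compatible one

bit : Bool → ℤ
bit true = 1ℤ
bit false = 0ℤ

gap : (a b : Fin n → Bool) → Fin n → ℤ
gap a b e = bit (a e) - bit (b e)

gap-trans : ∀ x y z → x - z ≡ (x - y) + (y - z)
gap-trans = solve-∀

turn : Sgn → Bool → Bool
turn plus q = not q
turn minus q = not q
turn zer q = q

turn-gap : ∀ {s q} → Agree s q → bit (turn s q) - bit q ≡ sgnℤ (negS s)
turn-gap {plus} refl = refl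
turn-gap {minus} refl = refl
turn-gap {zer} {q} _ = ℤ.+-inverseʳ (bit q)

-- Orientations are coded in a finite type because there every strict partial order is well founded.
decode : Fin (2 ℕ.^ n) → Fin n → Bool
decode i e = Inverse.to 2↔Bool (finToFun i e)

encode : (Fin n → Bool) → Fin (2 ℕ.^ n)
encode Q = funToFin (Inverse.from 2↔Bool ∘ Q)

decode-encode : (Q : Fin n → Bool) → ∀ e → decode (encode Q) e ≡ Q e
decode-encode Q e = trans (cong (Inverse.to 2↔Bool) (finToFun-funToFin (Inverse.from 2↔Bool ∘ Q) e))
  (Inverse.strictlyInverseˡ 2↔Bool (Q e))

module Reverse (S : Sys n) where
  open Sys S

  -- Acyclicity of the signature makes this relation irreflexive, so that
  -- reversing bad cycles terminates.
  _⊏_ : Fin (2 ℕ.^ n) → Fin (2 ℕ.^ n) → Set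
  i ⊏ j = ∃ λ K → All (λ C → Cyc C × s C ≡ true) K × K ≢ [] × (∀ e → gap (decode i) (decode j) e ≡ sumL K e)

  ⊏-isStrictPartialOrder : IsStrictPartialOrder _≡_ _⊏_
  ⊏-isStrictPartialOrder = record
    { isEquivalence = isEquivalence
    ; irrefl = irrefl
    ; trans = ⊏-trans
    ; <-resp-≈ = resp₂ _⊏_
    }
    where
    irrefl : ∀ {i j} → i ≡ j → ¬ (i ⊏ j)
    irrefl {i} refl (K , good , K≢[] , p) =
      K≢[] (acyclic K good λ e → trans (sym (p e)) (ℤ.+-inverseʳ (bit (decode i e))))

    ⊏-trans : ∀ {i j k} → i ⊏ j → j ⊏ k → i ⊏ k
    ⊏-trans ([] , _ , K≢[] , _) _ = ⊥-elim (K≢[] refl)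
    ⊏-trans {i} {j} {k} (C ∷ K , good , _ , p) (L , good′ , _ , q) = C ∷ K ++ L , All.++⁺ good good′ , (λ ()) ,
      λ e → trans (gap-trans (bit (decode i e)) (bit (decode j e)) (bit (decode k e)))
        (trans (cong₂ _+_ (p e) (q e)) (sym (sumL-++ (C ∷ K) L e)))

  Reachable : (Fin n → Bool) → Set
  Reachable O = ∃ λ P → GoodC S (one ∘ P) × Flow S (gap P O)

  reduce : ∀ i → Acc _⊏_ i → Reachable (decode i)
  reduce i (acc rec) with good? S (one ∘ decode i)
  ... | inj₁ g = decode i , g , flow-zero S (λ e → ℤ.+-inverseʳ (bit (decode i e)))
  ... | inj₂ (C , c , conf , sC) = extend (reduce (encode Q) (rec smaller))
    where
    Q : Fin n → Bool
    Q e = turn (lookup C e) (decode i e)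

    step : ∀ e → gap (decode (encode Q)) (decode i) e ≡ ⟪ neg C ⟫ e
    step e = trans (cong (λ b → bit b - bit (decode i e)) (decode-encode Q e))
      (trans (turn-gap (conf e)) (cong sgnℤ (sym (lookup-neg C e))))

    -- Reversing `C` adds `neg C` to the orientation, and this is the selected direction because `C`
    -- is bad.
    smaller : encode Q ⊏ i
    smaller = neg C ∷ [] , (neg-cyc c , s-neg S c sC) ∷ [] , (λ ()) ,
      λ e → trans (step e) (sym (ℤ.+-identityʳ _))

    extend : Reachable (decode (encode Q)) → Reachable (decode i)
    extend (P , g , fx) = P , g , flow-+ S
      (λ e → gap-trans (bit (P e)) (bit (decode (encode Q) e)) (bit (decode i e)))
      fx (flow-cong S (λ e → sym (step e)) (flow-cycle S (neg-cyc c)))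

  reachable : ∀ O → Reachable O
  reachable O with reduce (encode O) (spo-wellFounded ⊏-isStrictPartialOrder (encode O))
  ... | P , g , fx = P , g , flow-cong S (λ e → cong (λ b → bit (P e) - bit b) (decode-encode O e)) fx

gap-nonneg : ∀ a b {s} → Agree s a → 0ℤ ≤ (bit a - bit b) * sgnℤ s
gap-nonneg true true p = +≤+ z≤n
gap-nonneg false false p = +≤+ z≤n
gap-nonneg true false {plus} p = +≤+ z≤n
gap-nonneg true false {zer} p = +≤+ z≤n
gap-nonneg false true {minus} p = +≤+ z≤n
gap-nonneg false true {zer} p = +≤+ z≤n

gap-zero : ∀ a b → bit a - bit b ≡ 0ℤ → a ≡ b
gap-zero true true _ = refl
gap-zero false false _ = refl

-- Where `a` and `b` differ, their gap points along `a`, as does the cycle. All products are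
-- therefore nonnegative, and orthogonality makes them vanish.
avoid : (S : Sys n) {a b : Fin n → Bool} → Flow (dual S) (gap a b) → ∀ {C} → Sys.Cyc S C →
  Conforms (one ∘ a) C → ∀ e → a e ≢ b e → lookup C e ≡ zer
avoid S {a} {b} fy {C} c conf e a≢b with zer? (lookup C e)
... | yes p = p
... | no p = ⊥-elim (a≢b (gap-zero (a e) (b e) (*-sgnℤ-zero _ p
  (Σ-nonneg-zero (λ f → gap-nonneg (a f) (b f) (conf f)) (pairing fy C c) e))))

status : (o p q : Bool) → Status
status o p q with p Bool.≟ o | q Bool.≟ p
... | no _ | _ = cyc
... | yes _ | no _ = coc
... | yes _ | yes _ = keep

-- o, p, q are the states of an edge initially, after the cycle reversals, and
-- after the cocycle reversals.
Separate : (o p q : Bool) → Set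
Separate o p q = p ≢ o → q ≢ p → ⊥

status-reversed : ∀ o p q → Separate o p q → reversed q (status o p q) ≡ o
status-reversed true true true h = refl
status-reversed true true false h = refl
status-reversed true false false h = refl
status-reversed true false true h = ⊥-elim (h (λ ()) (λ ()))
status-reversed false true false h = ⊥-elim (h (λ ()) (λ ()))
status-reversed false true true h = refl
status-reversed false false true h = refl
status-reversed false false false h = refl

status-cyc : ∀ o p q → Separate o p q → cycVal q (status o p q) ≡ bit p - bit o
status-cyc true true true h = refl
status-cyc true true false h = refl
status-cyc true false false h = refl
status-cyc true false true h = ⊥-elim (h (λ ()) (λ ()))
status-cyc false true false h = ⊥-elim (h (λ ()) (λ ()))
status-cyc false true true h = refl
status-cyc false false true h = refl
status-cyc false false false h = refl

status-coc : ∀ o p q → Separate o p q → cycVal q (exchange (status o p q)) ≡ bit q - bit p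
status-coc true true true h = refl
status-coc true true false h = refl
status-coc true false false h = refl
status-coc true false true h = ⊥-elim (h (λ ()) (λ ()))
status-coc false true false h = ⊥-elim (h (λ ()) (λ ()))
status-coc false true true h = refl
status-coc false false true h = refl
status-coc false false false h = refl

record Reduction (S : Sys n) (O : Fin n → Bool) : Set where
  field
    T P : Fin n → Bool
    st : Fin n → Status
    datum : Datum S false T P st
    good : GoodC S (one ∘ P)
    good* : GoodC (dual S) (one ∘ P)
    start : ∀ e → reversed (P e) (st e) ≡ O e

-- Cycles are reversed from `O` to `P₁`, then cocycles from `P₁` to `P₂`. By `avoid`, directed
-- cycles of `P₂` miss the edges changed last, so they are already directed in `P₁` and the cycle
-- condition survives. For the same reason no edge is changed twice.
reduction : (S : Sys n) (O : Fin n → Bool) → Reduction S O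
reduction {n} S O with Reverse.reachable S O
... | P₁ , g₁ , x with Reverse.reachable (dual S) P₁
... | P₂ , g₂ , y = record
  { T = T
  ; P = P₂
  ; st = st
  ; datum = record
    { fund = proj₁ φ
    ; fund* = proj₂ φ
    ; cyc-flow = flow-cong S (λ e → sym (status-cyc (O e) (P₁ e) (P₂ e) (separate e))) x
    ; coc-flow = flow-cong (dual S) (λ e → sym (status-coc (O e) (P₁ e) (P₂ e) (separate e))) y
    }
  ; good = good
  ; good* = g₂
  ; start = λ e → status-reversed (O e) (P₁ e) (P₂ e) (separate e)
  }
  where
  y⁻ : Flow (dual S) (gap P₁ P₂)
  y⁻ = flow-neg (dual S) (λ e → neg-gap (bit (P₁ e)) (bit (P₂ e))) y
    where
    neg-gap : ∀ a b → a - b ≡ - (b - a)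
    neg-gap = solve-∀

  good : GoodC S (one ∘ P₂)
  good C c conf = g₁ C c λ e → agree₁ e
    where
    agree₁ : ∀ e → Agree (lookup C e) (P₁ e)
    agree₁ e with P₂ e Bool.≟ P₁ e
    ... | yes p = subst (Agree _) p (conf e)
    ... | no p = agree-zer (avoid S {P₂} {P₁} y c conf e p)

  separate : ∀ e → Separate (O e) (P₁ e) (P₂ e)
  separate e p q with conformal-cycle S x e (p ∘ gap-zero (P₁ e) (O e))
  ... | C , c , Ce≢0 , conf =
    Ce≢0 (avoid S {P₁} {P₂} y⁻ c (λ f → agree (P₁ f) (O f) (conf f)) e (q ∘ sym))
    where
    agree : ∀ a b {s} → Permits (paint (bit a - bit b)) s → Agree s a
    agree true true refl = tt
    agree false false refl = tt
    agree true false r = r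
    agree false true r = r

  st : Fin n → Status
  st e = status (O e) (P₁ e) (P₂ e)

  φ₀ = compatible-basis S P₂ good g₂
  T = proj₁ φ₀
  φ = proj₂ φ₀

-- Disjoint unions of directed cycles

union : List (Vec Sgn n) → Fin n → Bool
union L e = foldr (λ C b → nzB (lookup C e) ∨ b) false L

Apart-supports : Vec Sgn n → Vec Sgn n → Set
Apart-supports C D = ∀ e → lookup C e ≢ zer → ¬ (lookup D e ≢ zer)

nzB-true : ∀ {s} → s ≢ zer → nzB s ≡ true
nzB-true {plus} _ = refl
nzB-true {minus} _ = refl
nzB-true {zer} p = ⊥-elim (p refl)

without : Vec Sgn n → Vec Sgn n → Vec Sgn n
without V C = tabulate λ e → if nzB (lookup C e) then zer else lookup V e

module _ (V C : Vec Sgn n) where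
  without-zero : ∀ {e} → lookup C e ≢ zer → lookup (without V C) e ≡ zer
  without-zero {e} p = trans (lookup∘tabulate _ e) (cong (if_then zer else lookup V e) (nzB-true p))

  without-other : ∀ {e} → lookup C e ≡ zer → lookup (without V C) e ≡ lookup V e
  without-other {e} p = trans (lookup∘tabulate _ e) (cong (λ s → if nzB s then zer else lookup V e) p)

  without-⊑ : without V C ⊑ V
  without-⊑ e p with zer? (lookup C e)
  ... | yes q = without-other q
  ... | no q = ⊥-elim (p (without-zero q))

  without-value : C ⊑ V → ∀ e → ⟪ without V C ⟫ e ≡ ⟪ V ⟫ e + - ⟪ C ⟫ e
  without-value p e with zer? (lookup C e)
  ... | yes q = trans (cong sgnℤ (without-other q))
        (sym (trans (cong (λ s → ⟪ V ⟫ e + - sgnℤ s) q) (ℤ.+-identityʳ _)))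
  ... | no q = trans (cong sgnℤ (without-zero q))
        (sym (trans (cong (λ s → ⟪ V ⟫ e + - sgnℤ s) (p e q)) (ℤ.+-inverseʳ (⟪ V ⟫ e))))

  without-nzB : C ⊑ V → ∀ e → nzB (lookup C e) ∨ nzB (lookup (without V C) e) ≡ nzB (lookup V e)
  without-nzB p e with zer? (lookup C e)
  ... | yes q = cong₂ (λ s t → nzB s ∨ nzB t) q (without-other q)
  ... | no q = trans (cong (_∨ nzB (lookup (without V C) e)) (nzB-true q))
        (sym (trans (cong nzB (sym (p e q))) (nzB-true q)))

record Decomposition (S : Sys n) (V : Vec Sgn n) : Set where
  field
    cycles : List (Vec Sgn n)
    parts : All (λ C → Sys.Cyc S C × C ⊑ V) cycles
    disjoint : AllPairs Apart-supports cycles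
    covers : ∀ e → union cycles e ≡ nzB (lookup V e)

paint-sgn : ∀ {s t} → Permits (paint (sgnℤ t)) s → s ≢ zer → s ≡ t
paint-sgn {t = plus} p s≢0 = agree⇒sgn s≢0 p
paint-sgn {t = minus} p s≢0 = agree⇒sgn s≢0 p
paint-sgn {t = zer} p s≢0 = ⊥-elim (s≢0 p)

-- With entries 0 and ±1, a conforming cycle equals `V` on its own support. Subtracting it merely
-- erases that part, so the rest is again a signed vector, and later cycles are disjoint from this
-- one.
decompose : (S : Sys n) → ∀ m V → size V ℕ.≤ m → Flow S ⟪ V ⟫ → Decomposition S V
decompose {n} S m V V≤m fx with either-all nonzero
  where
  nonzero : ∀ e → lookup V e ≢ zer ⊎ lookup V e ≡ zer
  nonzero e with zer? (lookup V e)
  ... | yes p = inj₂ p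
  ... | no p = inj₁ p
... | inj₂ V≡0 = record
  { cycles = [] ; parts = [] ; disjoint = [] ; covers = λ e → sym (cong nzB (V≡0 e)) }
... | inj₁ (e , Ve≢0) with conformal-cycle S fx e (sgnℤ-nonzero Ve≢0)
... | C , c , Ce≢0 , conf = go m V≤m
  where
  C⊑V : C ⊑ V
  C⊑V f = paint-sgn (conf f)

  W = without V C

  W<V : size W ℕ.< size V
  W<V = size-strict W V (⊑-supp {C = W} {V} (without-⊑ V C)) e (without-zero V C Ce≢0) Ve≢0

  go : ∀ m → size V ℕ.≤ m → Decomposition S V
  go zero V≤0 with ℕ.≤-trans W<V V≤0
  ... | ()
  go (suc m) V≤m = record
    { cycles = C ∷ cycles
    ; parts = (c , C⊑V) ∷ All.map (λ {B} (b , B⊑W) → b , ⊑-trans {U = B} {W} {V} B⊑W (without-⊑ V C)) parts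
    ; disjoint = All.map (λ {B} (b , B⊑W) f Cf≢0 Bf≢0 →
        ⊑-supp {C = B} {W} B⊑W f Bf≢0 (without-zero V C Cf≢0)) parts ∷ disjoint
    ; covers = λ f → trans (cong (nzB (lookup C f) ∨_) (covers f)) (without-nzB V C C⊑V f)
    }
    where
    open Decomposition (decompose S m W (ℕ.s≤s⁻¹ (ℕ.≤-trans W<V V≤m))
      (flow-+ S (without-value V C C⊑V) fx (flow-neg S (λ _ → refl) (flow-cycle S c))))

-- Reversals given by explicit families of cycles and cocycles

record Reversal (S : Sys n) (O X : Fin n → Bool) : Set where
  field
    T P : Fin n → Bool
    fund : Fund S T P
    good : GoodC S (one ∘ P)
    good* : GoodC (dual S) (one ∘ P)
    Cs Ds : List (Vec Sgn n)
    cycles : All (λ C → Sys.Cyc S C × Conforms (one ∘ P) C) Cs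
    cocycles : All (λ D → Sys.Coc S D × Conforms (one ∘ P) D) Ds
    disjoint : AllPairs Apart-supports (Cs ++ Ds)
    O-value : ∀ e → O e ≡ (if union (Cs ++ Ds) e then not (P e) else P e)
    X-value : ∀ e → X e ≡ (T e ∨ union Cs e) ∧ not (union Ds e)

union-++ : ∀ (K L : List (Vec Sgn n)) e → union (K ++ L) e ≡ union K e ∨ union L e
union-++ [] L e = refl
union-++ (C ∷ K) L e = trans (cong (nzB (lookup C e) ∨_) (union-++ K L e))
  (sym (Bool.∨-assoc (nzB (lookup C e)) (union K e) (union L e)))

union-apart : ∀ (C : Vec Sgn n) {L e} → All (Apart-supports C) L → lookup C e ≢ zer → union L e ≡ false
union-apart C [] p = refl
union-apart C {D ∷ L} {e} (q ∷ qs) p with zer? (lookup D e)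
... | yes r rewrite r = union-apart C qs p
... | no r = ⊥-elim (q e p r)

union-disjoint : ∀ (K L : List (Vec Sgn n)) {e} → AllPairs Apart-supports (K ++ L) →
  union K e ≡ true → union L e ≡ true → ⊥
union-disjoint (C ∷ K) L {e} (q ∷ qs) p r with zer? (lookup C e)
... | yes z = union-disjoint K L qs (trans (sym (cong (λ s → nzB s ∨ union K e) z)) p) r
... | no z with trans (sym r) (union-apart C (All.++⁻ʳ K q) z)
... | ()

prefix : ∀ (K : List (Vec Sgn n)) {L} → AllPairs Apart-supports (K ++ L) → AllPairs Apart-supports K
prefix [] _ = []
prefix (C ∷ K) (q ∷ qs) = All.++⁻ˡ K q ∷ prefix K qs

suffix : ∀ (K : List (Vec Sgn n)) {L} → AllPairs Apart-supports (K ++ L) → AllPairs Apart-supports L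
suffix [] qs = qs
suffix (C ∷ K) (_ ∷ qs) = suffix K qs

sumL-union : ∀ (S : Sys n) {P L} → All (λ C → Sys.Cyc S C × Conforms (one ∘ P) C) L →
  AllPairs Apart-supports L → ∀ e → sumL L e ≡ (if union L e then sgnℤ (sgn (P e)) else 0ℤ)
sumL-union S [] [] e = refl
sumL-union S {P} {C ∷ L} ((_ , conf) ∷ cs) (q ∷ qs) e with zer? (lookup C e)
... | yes z rewrite z = trans (ℤ.+-identityˡ _) (sumL-union S cs qs e)
... | no z rewrite nzB-true z | sumL-union S cs qs e | union-apart C {e = e} q z =
  trans (ℤ.+-identityʳ _) (cong sgnℤ (agree⇒sgn z (conf e)))

flow-sum : (S : Sys n) {Q : Vec Sgn n → Set} {L : List (Vec Sgn n)} →
  All (λ C → Sys.Cyc S C × Q C) L → Flow S (sumL L)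
flow-sum S [] = flow-zero S λ _ → refl
flow-sum S ((c , _) ∷ cs) = flow-+ S (λ _ → refl) (flow-cycle S c) (flow-sum S cs)

marked : Bool → Bool → Status
marked true _ = cyc
marked false true = coc
marked false false = keep

module FromReversal {S : Sys n} {O X : Fin n → Bool} (R : Reversal S O X) where
  open Reversal R

  st : Fin n → Status
  st e = marked (union Cs e) (union Ds e)

  not-both : ∀ e → union Cs e ≡ true → union Ds e ≡ true → ⊥
  not-both e = union-disjoint Cs Ds disjoint

  marked-cyc : ∀ p u w → (if u then sgnℤ (sgn p) else 0ℤ) ≡ cycVal p (marked u w)
  marked-cyc p true w = refl
  marked-cyc p false true = refl
  marked-cyc p false false = refl

  marked-coc : ∀ p u w → (u ≡ true → w ≡ true → ⊥) →
    (if w then sgnℤ (sgn p) else 0ℤ) ≡ cycVal p (exchange (marked u w))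
  marked-coc p true true h = ⊥-elim (h refl refl)
  marked-coc p true false h = refl
  marked-coc p false true h = refl
  marked-coc p false false h = refl

  datum : Datum S false T P st
  datum = record
    { fund = proj₁ fund
    ; fund* = proj₂ fund
    ; cyc-flow = flow-cong S (λ e → trans (sumL-union S cycles (prefix Cs disjoint) e)
        (marked-cyc (P e) (union Cs e) (union Ds e))) (flow-sum S cycles)
    ; coc-flow = flow-cong (dual S) (λ e → trans (sumL-union (dual S) cocycles (suffix Cs disjoint) e)
        (marked-coc (P e) (union Cs e) (union Ds e) (not-both e))) (flow-sum (dual S) cocycles)
    }

  O-reversed : ∀ e → O e ≡ reversed (P e) (st e)
  O-reversed e = trans (O-value e) (trans (cong (if_then not (P e) else P e) (union-++ Cs Ds e))
    (value (union Cs e) (union Ds e)))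
    where
    value : ∀ u w {p} → (if u ∨ w then not p else p) ≡ reversed p (marked u w)
    value true w = refl
    value false true = refl
    value false false = refl

  X-updated : ∀ e → X e ≡ updated false (T e) (st e)
  X-updated e = trans (X-value e) (value (T e) (union Cs e) (union Ds e) (not-both e))
    where
    value : ∀ t u w → (u ≡ true → w ≡ true → ⊥) → (t ∨ u) ∧ not w ≡ updated false t (marked u w)
    value t true true h = ⊥-elim (h refl refl)
    value true true false h = refl
    value false true false h = refl
    value true false true h = refl
    value false false true h = refl
    value true false false h = refl
    value false false false h = refl

reversal-unique : (S : Sys n) {O X O′ X′ : Fin n → Bool} → Reversal S O X → Reversal S O′ X′ →
  (∀ e → O e ≡ O′ e ⊎ X e ≡ X′ e) → ∀ e → O e ≡ O′ e × X e ≡ X′ e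
reversal-unique S {O} {X} {O′} {X′} R R′ h e =
  trans (A.O-reversed e) (trans (proj₁ same) (sym (B.O-reversed e))) ,
  trans (A.X-updated e) (trans (proj₂ same) (sym (B.X-updated e)))
  where
  module A = FromReversal R
  module B = FromReversal R′
  same = datum-unique S A.datum B.datum
    (λ f → Sum.map (λ p → trans (sym (A.O-reversed f)) (trans p (B.O-reversed f)))
                   (λ p → trans (sym (A.X-updated f)) (trans p (B.X-updated f))) (h f)) e

isCyc : Status → Bool
isCyc cyc = true
isCyc keep = false
isCyc coc = false

vector : (P : Fin n → Bool) (st : Fin n → Status) → Vec Sgn n
vector P st = tabulate λ e → if isCyc (st e) then sgn (P e) else zer

vector-value : ∀ P st (e : Fin n) → ⟪ vector P st ⟫ e ≡ cycVal (P e) (st e)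
vector-value P st e = trans (cong sgnℤ (lookup∘tabulate _ e)) (value (P e) (st e))
  where
  value : ∀ p u → sgnℤ (if isCyc u then sgn p else zer) ≡ cycVal p u
  value p keep = refl
  value p cyc = refl
  value p coc = refl

vector-nzB : ∀ P st (e : Fin n) → nzB (lookup (vector P st) e) ≡ isCyc (st e)
vector-nzB P st e = trans (cong nzB (lookup∘tabulate _ e)) (value (P e) (st e))
  where
  value : ∀ p u → nzB (if isCyc u then sgn p else zer) ≡ isCyc u
  value true cyc = refl
  value false cyc = refl
  value p keep = refl
  value p coc = refl

vector-agree : ∀ P st (e : Fin n) → Agree (lookup (vector P st) e) (P e)
vector-agree P st e = subst (λ s → Agree s (P e)) (sym (lookup∘tabulate _ e)) (value (P e) (isCyc (st e)))
  where
  value : ∀ p b → Agree (if b then sgn p else zer) p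
  value p true = Agree-sgn p
  value p false = tt

vectors-apart : ∀ P st (e : Fin n) → lookup (vector P st) e ≢ zer →
  ¬ (lookup (vector P (exchange ∘ st)) e ≢ zer)
vectors-apart P st e p q = value (st e) (trans (sym (vector-nzB P st e)) (nzB-true p))
  (trans (sym (vector-nzB P (exchange ∘ st) e)) (nzB-true q))
  where
  value : ∀ u → isCyc u ≡ true → isCyc (exchange u) ≡ true → ⊥
  value cyc _ ()
  value keep ()
  value coc ()

isCyc-reversed : ∀ u p → (if isCyc u ∨ isCyc (exchange u) then not p else p) ≡ reversed p u
isCyc-reversed keep p = refl
isCyc-reversed cyc p = refl
isCyc-reversed coc p = refl

isCyc-updated : ∀ u t → updated false t u ≡ (t ∨ isCyc u) ∧ not (isCyc (exchange u))
isCyc-updated keep true = refl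
isCyc-updated keep false = refl
isCyc-updated cyc true = refl
isCyc-updated cyc false = refl
isCyc-updated coc true = refl
isCyc-updated coc false = refl

assemble : (S : Sys n) {O : Fin n → Bool} (R : Reduction S O) →
  Decomposition S (vector (Reduction.P R) (Reduction.st R)) →
  Decomposition (dual S) (vector (Reduction.P R) (exchange ∘ Reduction.st R)) →
  Reversal S O (λ e → updated false (Reduction.T R e) (Reduction.st R e))
assemble {n} S {O} R Δ Δ* = record
  { T = T
  ; P = P
  ; fund = Datum.fund datum , Datum.fund* datum
  ; good = good
  ; good* = good*
  ; Cs = Δ.cycles
  ; Ds = Δ*.cycles
  ; cycles = All.map (λ {C} (c , C⊑V) → c ,
      ⊑-permits {C = C} {V} {one ∘ P} C⊑V (vector-agree P st)) Δ.parts
  ; cocycles = All.map (λ {D} (d , D⊑V) → d ,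
      ⊑-permits {C = D} {V*} {one ∘ P} D⊑V (vector-agree P (exchange ∘ st))) Δ*.parts
  ; disjoint = AllPairs.++⁺ Δ.disjoint Δ*.disjoint
      (All.map (λ {C} (_ , C⊑V) → All.map (λ {D} (_ , D⊑V) e p q → vectors-apart P st e
        (⊑-supp {C = C} {V} C⊑V e p) (⊑-supp {C = D} {V*} D⊑V e q)) Δ*.parts) Δ.parts)
  ; O-value = O-value
  ; X-value = λ e → trans (isCyc-updated (st e) (T e))
      (sym (cong₂ (λ u w → (T e ∨ u) ∧ not w) (covers e) (covers* e)))
  }
  where
  open Reduction R
  V V* : Vec Sgn n
  V = vector P st
  V* = vector P (exchange ∘ st)
  module Δ = Decomposition Δ
  module Δ* = Decomposition Δ*
  covers : ∀ e → union Δ.cycles e ≡ isCyc (st e)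
  covers e = trans (Δ.covers e) (vector-nzB P st e)
  covers* : ∀ e → union Δ*.cycles e ≡ isCyc (exchange (st e))
  covers* e = trans (Δ*.covers e) (vector-nzB P (exchange ∘ st) e)
  O-value : ∀ e → O e ≡ (if union (Δ.cycles ++ Δ*.cycles) e then not (P e) else P e)
  O-value e = sym (trans (cong (if_then not (P e) else P e) (trans (union-++ Δ.cycles Δ*.cycles e)
    (cong₂ _∨_ (covers e) (covers* e)))) (trans (isCyc-reversed (st e) (P e)) (start e)))

reversal : (S : Sys n) (O : Fin n → Bool) → ∃ λ X → Reversal S O X
reversal S O = _ , assemble S R
  (decompose S _ _ ℕ.≤-refl (flow-cong S (λ e → sym (vector-value P st e)) (Datum.cyc-flow datum)))
  (decompose (dual S) _ _ ℕ.≤-refl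
    (flow-cong (dual S) (λ e → sym (vector-value P (exchange ∘ st) e)) (Datum.coc-flow datum)))
  where
  R = reduction S O
  open Reduction R

-- Covering: prescribing direction or membership edge by edge

record Prescribed (S : Sys n) (free o x : Fin n → Bool) : Set where
  field
    O X : Fin n → Bool
    reversed-by : Reversal S O X
    outside : ∀ e → free e ≡ false → O e ≡ o e
    inside : ∀ e → free e ≡ true → X e ≡ x e

-- Among two reversals prescribed alike except for the direction of e, the value of
-- X at e differs by uniqueness, so prescribing X at e instead is possible as well.
prescribed : (S : Sys n) (L : List (Fin n)) (free : Fin n → Bool) (o x : Fin n → Bool) →
  (∀ e → free e ≡ true → e ∈ L) →
  Prescribed S free o x
prescribed S [] free o x within = record
  { O = o
  ; X = proj₁ (reversal S o)
  ; reversed-by = proj₂ (reversal S o)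
  ; outside = λ _ _ → refl
  ; inside = λ e p → none-in (within e p)
  }
  where
  none-in : ∀ {e} {A : Set} → e ∈ [] → A
  none-in ()
prescribed {n} S (e ∷ L) free o x within with free e in q
... | false = prescribed S L free o x within′
  where
  within′ : ∀ f → free f ≡ true → f ∈ L
  within′ f p with within f p
  ... | there f∈L = f∈L
  ... | here refl with trans (sym q) p
  ... | ()
... | true = choose (A.X e Bool.≟ x e) (B.X e Bool.≟ x e)
  where
  free′ : Fin n → Bool
  free′ = upd free e false

  within′ : ∀ f → free′ f ≡ true → f ∈ L
  within′ f p with f ≟F e
  within′ f () | yes _
  ... | no f≢e with within f p
  ... | here f≡e = ⊥-elim (f≢e f≡e)
  ... | there f∈L = f∈L

  module Candidate (b : Bool) where
    open Prescribed (prescribed S L free′ (upd o e b) x within′) public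

    off : ∀ {f} → f ≢ e → free f ≡ false → O f ≡ o f
    off {f} f≢e p = trans (outside f (trans (upd-other free f≢e) p)) (upd-other o f≢e)

    on : ∀ {f} → f ≢ e → free f ≡ true → X f ≡ x f
    on {f} f≢e p = inside f (trans (upd-other free f≢e) p)

    at-e : O e ≡ b
    at-e = trans (outside e (upd-same free e false)) (upd-same o e b)

    take : X e ≡ x e → Prescribed S free o x
    take r = record { O = O ; X = X ; reversed-by = reversed-by ; outside = outside′ ; inside = inside′ }
      where
      outside′ : ∀ f → free f ≡ false → O f ≡ o f
      outside′ f p with f ≟F e
      ... | no f≢e = off f≢e p
      ... | yes refl with trans (sym q) p
      ... | ()
      inside′ : ∀ f → free f ≡ true → X f ≡ x f
      inside′ f p with f ≟F e
      ... | no f≢e = on f≢e p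
      ... | yes refl = r

  module A = Candidate true
  module B = Candidate false

  choose : Dec (A.X e ≡ x e) → Dec (B.X e ≡ x e) → Prescribed S free o x
  choose (yes r) _ = A.take r
  choose (no _) (yes r) = B.take r
  choose (no r) (no r′)
    = ⊥-elim (true≢false (trans (sym A.at-e)
        (trans (proj₁ (reversal-unique S A.reversed-by B.reversed-by agree e)) B.at-e)))
    where
    true≢false : true ≢ false
    true≢false ()
    agree : ∀ f → A.O f ≡ B.O f ⊎ A.X f ≡ B.X f
    agree f with f ≟F e | free f in p
    ... | yes refl | _ = inj₂ (trans (¬-not r) (sym (¬-not r′)))
    ... | no f≢e | false = inj₁ (trans (A.off f≢e p) (sym (B.off f≢e p)))
    ... | no f≢e | true = inj₂ (trans (A.on f≢e p) (sym (B.on f≢e p)))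

-- The cycles and cocycles of a graph

all-Vec? : Searchable A → {P : Vec A n → Set} → Decidable P → Dec (∀ v → P v)
all-Vec? s P? with search-Vec s (¬? ∘ P?)
... | yes (v , p) = no λ all → p (all v)
... | no p = yes λ v → decidable-stable (P? v) λ q → p (v , q)

nonzero? : (C : Vec Sgn n) → Dec (∃ λ e → lookup C e ≢ zer)
nonzero? C = any? λ e → ¬? (zer? (lookup C e))

elementary? : {P : Vec Sgn n → Set} → Decidable P → Decidable (Elementary P)
elementary? P? C = P? C ×-dec nonzero? C ×-dec all-Vec? search-Sgn λ V →
  P? V →-dec (nonzero? V →-dec ((all? λ e → ¬? (zer? (lookup V e)) →-dec ¬? (zer? (lookup C e))) →-dec
    all? λ e → ¬? (zer? (lookup C e)) →-dec ¬? (zer? (lookup V e))))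

elementary-neg : {P : Vec Sgn n → Set} → (∀ {C} → P C → P (neg C)) →
  ∀ {C} → Elementary P C → Elementary P (neg C)
elementary-neg h {C} (p , (e , Ce≢0) , minimal) = h p , (e , neg-nonzero C Ce≢0) ,
  λ V v V≢0 V⊆C f q → minimal V v V≢0 (λ g → neg-nonzero⁻ C ∘ V⊆C g) f (neg-nonzero⁻ C q)

module Boundary (G : Graph) where
  V = Fin (nV G)
  E = Fin (nE G)

  from to : Bool → E → V
  from true = tail G
  from false = head G
  to true = head G
  to false = tail G

  ∂ : E → V → ℤ
  ∂ e u = ind (head G e) u - ind (tail G e) u

  div : SVec G → V → ℤ
  div C u = Σℤ λ e → ⟪ C ⟫ e * ∂ e u

  ∂-dir : ∀ b e u → sgnℤ (sgn b) * ∂ e u ≡ ind (to b e) u - ind (from b e) u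
  ∂-dir true e u = ℤ.*-identityˡ _
  ∂-dir false e u = flip-∂ (ind (head G e) u) (ind (tail G e) u)
    where
    flip-∂ : ∀ a b → - 1ℤ * (a - b) ≡ b - a
    flip-∂ = solve-∀

  div-neg : ∀ C u → div (neg C) u ≡ - div C u
  div-neg C u = dot-neg {x = ⟪ C ⟫} (λ e → ∂ e u) (⟪neg⟫ C)

  div-update : ∀ C e b u → lookup C e ≡ zer →
    div (C [ e ]≔ sgn b) u ≡ div C u + (ind (to b e) u - ind (from b e) u)
  div-update C e b u z = trans (dot-+ˡ {x = ⟪ C ⟫} {λ f → sgnℤ (sgn b) * ind e f} (λ f → ∂ f u) split)
    (cong (div C u +_) (trans (Σ-single _ e off) (trans (cong (λ i → sgnℤ (sgn b) * i * ∂ e u) (ind-refl e))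
      (trans (cong (_* ∂ e u) (ℤ.*-identityʳ (sgnℤ (sgn b)))) (∂-dir b e u)))))
    where
    split : ∀ f → ⟪ C [ e ]≔ sgn b ⟫ f ≡ ⟪ C ⟫ f + sgnℤ (sgn b) * ind e f
    split f with f ≟F e
    ... | yes refl rewrite lookup∘update e C (sgn b) | z | ind-refl e =
      sym (trans (ℤ.+-identityˡ _) (ℤ.*-identityʳ (sgnℤ (sgn b))))
    ... | no f≢e rewrite lookup∘update′ f≢e C (sgn b) | ind-≢ (f≢e ∘ sym) =
      sym (trans (cong (⟪ C ⟫ f +_) (ℤ.*-zeroʳ (sgnℤ (sgn b)))) (ℤ.+-identityʳ _))
    off : ∀ f → f ≢ e → sgnℤ (sgn b) * ind e f * ∂ f u ≡ 0ℤ
    off f f≢e = cong (_* ∂ f u) (trans (cong (sgnℤ (sgn b) *_) (ind-≢ (f≢e ∘ sym))) (ℤ.*-zeroʳ (sgnℤ (sgn b))))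

  -- Summation by parts. A cut is, up to sign, the difference of an indicator function along the
  -- edges, so flows are orthogonal to cuts.
  potential : ∀ C (y : V → ℤ) → Σℤ (λ e → ⟪ C ⟫ e * (y (head G e) - y (tail G e))) ≡ Σℤ λ u → y u * div C u
  potential C y = trans (Σ-cong expand) (trans (Σ-swap λ e u → y u * (⟪ C ⟫ e * ∂ e u))
    (Σ-cong λ u → Σ-*ˡ (y u) (λ e → ⟪ C ⟫ e * ∂ e u)))
    where
    distribute : ∀ a b c → a * (b - c) ≡ a * b + - 1ℤ * (a * c)
    distribute = solve-∀
    value : ∀ e → Σℤ (λ u → y u * ∂ e u) ≡ y (head G e) - y (tail G e)
    value e = trans (Σ-cong λ u → distribute (y u) (ind (head G e) u) (ind (tail G e) u))
      (trans (Σ-+ (λ u → y u * ind (head G e) u) (λ u → - 1ℤ * (y u * ind (tail G e) u)))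
        (cong₂ _+_ (Σ-ind y (head G e)) (trans (Σ-*ˡ (- 1ℤ) (λ u → y u * ind (tail G e) u))
          (trans (ℤ.-1*i≡-i _) (cong -_ (Σ-ind y (tail G e)))))))
    regroup : ∀ c y d → c * (y * d) ≡ y * (c * d)
    regroup = solve-∀
    expand : ∀ e → ⟪ C ⟫ e * (y (head G e) - y (tail G e)) ≡ Σℤ λ u → y u * (⟪ C ⟫ e * ∂ e u)
    expand e = trans (cong (⟪ C ⟫ e *_) (sym (value e)))
      (trans (sym (Σ-*ˡ (⟪ C ⟫ e) (λ u → y u * ∂ e u))) (Σ-cong λ u → regroup (⟪ C ⟫ e) (y u) (∂ e u)))

  IsCut : SVec G → Set
  IsCut D = ∃ λ X → D ≡ cutVec G X

  cut-value : ∀ X e → ⟪ cutVec G X ⟫ e ≡ - (bit (lookup X (head G e)) - bit (lookup X (tail G e)))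
  cut-value X e = trans (cong sgnℤ (lookup∘tabulate _ e)) (value (lookup X (tail G e)) _)
    where
    value : ∀ a b → sgnℤ (cutSign a b) ≡ - (bit b - bit a)
    value true true = refl
    value true false = refl
    value false true = refl
    value false false = refl

  flow-cut : ∀ {C D} → IsFlow G C → IsCut D → ⟨ ⟪ C ⟫ , ⟪ D ⟫ ⟩ ≡ 0ℤ
  flow-cut {C} c (X , refl) = trans (dot-comm ⟪ C ⟫ ⟪ cutVec G X ⟫)
    (trans (dot-neg {x = δ} ⟪ C ⟫ (cut-value X)) (cong -_ (trans (dot-comm δ ⟪ C ⟫)
      (trans (potential C (λ u → bit (lookup X u)))
        (Σ-zero λ u → trans (cong (bit (lookup X u) *_) (c u)) (ℤ.*-zeroʳ (bit (lookup X u))))))))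
    where
    δ : E → ℤ
    δ e = bit (lookup X (head G e)) - bit (lookup X (tail G e))

  flow-negated : ∀ {C} → IsFlow G C → IsFlow G (neg C)
  flow-negated {C} c u = trans (div-neg C u) (cong -_ (c u))

  cut-negated : ∀ {D} → IsCut D → IsCut (neg D)
  cut-negated (X , refl) = map not X , trans (sym (tabulate-∘ negS _)) (tabulate-cong λ e →
    trans (value (lookup X (tail G e)) _)
      (sym (cong₂ cutSign (lookup-map (tail G e) not X) (lookup-map (head G e) not X))))
    where
    value : ∀ a b → negS (cutSign a b) ≡ cutSign (not a) (not b)
    value true true = refl
    value true false = refl
    value false true = refl
    value false false = refl

  flow? : Decidable (IsFlow G)
  flow? C = all? λ u → div C u ℤ.≟ 0ℤ

  sgn-≟ : (s t : Sgn) → Dec (s ≡ t)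
  sgn-≟ plus plus = yes refl
  sgn-≟ plus minus = no λ ()
  sgn-≟ plus zer = no λ ()
  sgn-≟ minus plus = no λ ()
  sgn-≟ minus minus = yes refl
  sgn-≟ minus zer = no λ ()
  sgn-≟ zer plus = no λ ()
  sgn-≟ zer minus = no λ ()
  sgn-≟ zer zer = yes refl

  cut? : Decidable IsCut
  cut? D = search-Vec search-Bool λ X → ≡-dec sgn-≟ D (cutVec G X)

  -- Reachability along a painting and Minty's lemma for graphs

  Closed : (E → Paint) → (V → Bool) → Set
  Closed F X = ∀ e b → Permits (F e) (sgn b) → X (from b e) ≡ true → X (to b e) ≡ true

  -- Encoded as a signed vector over the vertices so that `size` measures the progress of the
  -- search.
  unreached : (V → Bool) → Vec Sgn (nV G)
  unreached X = tabulate λ v → if X v then zer else plus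

  unreached-true : ∀ X {v} → X v ≡ true → lookup (unreached X) v ≡ zer
  unreached-true X {v} p = trans (lookup∘tabulate _ v) (cong (if_then zer else plus) p)

  unreached-false : ∀ X {v} → X v ≡ false → lookup (unreached X) v ≢ zer
  unreached-false X {v} p q with trans (sym q) (trans (lookup∘tabulate _ v) (cong (if_then zer else plus) p))
  ... | ()

  reach-more : ∀ X {w} → X w ≡ false → size (unreached (upd X w true)) ℕ.< size (unreached X)
  reach-more X {w} p = size-strict (unreached (upd X w true)) (unreached X) sub w
    (unreached-true (upd X w true) (upd-same X w true)) (unreached-false X p)
    where
    sub : ∀ v → lookup (unreached (upd X w true)) v ≢ zer → lookup (unreached X) v ≢ zer
    sub v q with v ≟F w
    ... | yes refl = unreached-false X p
    ... | no v≢w with X v in r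
    ... | true = ⊥-elim (q (unreached-true (upd X w true) (trans (upd-other X v≢w) r)))
    ... | false = unreached-false X r

  -- Search along permitted edges that carries evidence `Q` for every reached vertex. `Q` may depend
  -- on the reached set, because the paths used for Minty's lemma must stay inside it.
  module Grow (F : E → Paint) (Q : (V → Bool) → V → Set)
    (mono : ∀ X v w → Q X v → Q (upd X w true) v)
    (step : ∀ X e b → Permits (F e) (sgn b) → X (from b e) ≡ true → X (to b e) ≡ false →
      Q X (from b e) → Q (upd X (to b e) true) (to b e)) where

    record Closure (X : V → Bool) : Set where
      field
        Y : V → Bool
        extends : ∀ v → X v ≡ true → Y v ≡ true
        reached : ∀ v → Y v ≡ true → Q Y v
        closed : Closed F Y

    Exit : (V → Bool) → E → Set
    Exit X e = ∃ λ b → Permits (F e) (sgn b) × X (from b e) ≡ true × X (to b e) ≡ false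

    exit? : ∀ X e → Exit X e ⊎ (∀ b → Permits (F e) (sgn b) → X (from b e) ≡ true → X (to b e) ≡ true)
    exit? X e with search-Bool (λ b → Permits? (F e) (sgn b) ×-dec (X (from b e) Bool.≟ true) ×-dec (X (to b e) Bool.≟ false))
    ... | yes x = inj₁ x
    ... | no x = inj₂ λ b p q → ¬-not λ r → x (b , p , q , r)

    grow : ∀ m X → size (unreached X) ℕ.≤ m → (∀ v → X v ≡ true → Q X v) → Closure X
    grow m X bound paths with either-all (exit? X)
    ... | inj₂ closed = record { Y = X ; extends = λ _ p → p ; reached = paths ; closed = closed }
    grow zero X bound paths | inj₁ (e , b , _ , _ , r) with ℕ.≤-trans (reach-more X r) bound
    ... | ()
    grow (suc m) X bound paths | inj₁ (e , b , p , q , r) = record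
      { Y = Y
      ; extends = λ v x → extends v (keeps v x)
      ; reached = reached
      ; closed = closed
      }
      where
      w = to b e
      X′ = upd X w true

      keeps : ∀ v → X v ≡ true → X′ v ≡ true
      keeps v x with v ≟F w
      ... | yes _ = refl
      ... | no _ = x

      paths′ : ∀ v → X′ v ≡ true → Q X′ v
      paths′ v x with v ≟F w
      ... | yes refl = step X e b p q r (paths (from b e) q)
      ... | no _ = mono X v w (paths v x)

      open Closure (grow m X′ (ℕ.s≤s⁻¹ (ℕ.≤-trans (reach-more X r) bound)) paths′)

  module Painting (F : E → Paint) (e : E) {b : Bool} (Fe : F e ≡ one b) where
    F′ : E → Paint
    F′ = upd F e none

    a z : V
    a = from b e
    z = to b e

    record Path (X : V → Bool) (v : V) : Set where
      field
        path : SVec G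
        conforms : Conforms F′ path
        ends : ∀ u → div path u ≡ ind v u - ind z u
        inside : ∀ f c → X (to c f) ≡ false → lookup path f ≡ zer

    upd-mono : ∀ (X : V → Bool) (w v : V) → upd X w true v ≡ false → X v ≡ false
    upd-mono X w v p with v ≟F w
    upd-mono X w v () | yes _
    ... | no _ = p

    mono : ∀ X v w → Path X v → Path (upd X w true) v
    mono X v w π = record
      { path = path
      ; conforms = conforms
      ; ends = ends
      ; inside = λ f c q → inside f c (upd-mono X w (to c f) q)
      }
      where open Path π

    telescope : ∀ x y z → (x - z) + (y - x) ≡ y - z
    telescope = solve-∀

    step : ∀ X f c → Permits (F′ f) (sgn c) → X (from c f) ≡ true → X (to c f) ≡ false →
      Path X (from c f) → Path (upd X (to c f) true) (to c f)
    step X f c p q r π = record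
      { path = path [ f ]≔ sgn c
      ; conforms = conforms′
      ; ends = λ u → trans (div-update path f c u (inside f c r))
          (trans (cong (_+ (ind (to c f) u - ind (from c f) u)) (ends u))
            (telescope (ind (from c f) u) (ind (to c f) u) (ind z u)))
      ; inside = inside′
      }
      where
      open Path π
      w = to c f

      conforms′ : Conforms F′ (path [ f ]≔ sgn c)
      conforms′ g with g ≟F f
      ... | yes refl = subst (Permits (F′ g)) (sym (lookup∘update g path (sgn c))) p
      ... | no g≢f = subst (Permits (F′ g)) (sym (lookup∘update′ g≢f path (sgn c))) (conforms g)

      ends-reached : ∀ c d → X (from c f) ≡ true → upd X (to c f) true (to d f) ≡ true
      ends-reached c d x with to d f ≟F to c f
      ends-reached c d x | yes _ = refl
      ends-reached true true x | no ≢ = ⊥-elim (≢ refl)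
      ends-reached false false x | no ≢ = ⊥-elim (≢ refl)
      ends-reached true false x | no _ = x
      ends-reached false true x | no _ = x

      inside′ : ∀ g d → upd X w true (to d g) ≡ false → lookup (path [ f ]≔ sgn c) g ≡ zer
      inside′ g d x with g ≟F f
      ... | no g≢f = trans (lookup∘update′ g≢f path (sgn c)) (inside g d (upd-mono X w (to d g) x))
      ... | yes refl with trans (sym x) (ends-reached c d q)
      ... | ()

    start : V → Bool
    start = upd (λ _ → false) z true

    trivial : ∀ v → start v ≡ true → Path start v
    trivial v p with v ≟F z
    trivial v () | no _
    ... | yes refl = record
      { path = replicate _ zer
      ; conforms = λ f → subst (Permits (F′ f)) (sym (lookup-replicate f zer)) (permits-zer (F′ f))
      ; ends = λ u → trans (Σ-zero λ f → cong (λ s → sgnℤ s * ∂ f u) (lookup-replicate f zer))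
          (sym (ℤ.+-inverseʳ (ind z u)))
      ; inside = λ f _ _ → lookup-replicate f zer
      }

    open Grow F′ Path mono step

    closure : Closure start
    closure = grow _ start ℕ.≤-refl trivial

    cycle-through : ∀ {X} → Path X a → Through (IsFlow G) F e
    cycle-through π = path [ e ]≔ sgn b ,
      (λ u → trans (div-update path e b u path-e) (trans (cong (_+ (ind z u - ind a u)) (ends u))
        (cancel (ind a u) (ind z u)))) ,
      (λ q → sgn-nonzero b (trans (sym (lookup∘update e path (sgn b))) q)) , conforms″
      where
      open Path π
      cancel : ∀ x y → (x - y) + (y - x) ≡ 0ℤ
      cancel = solve-∀
      path-e : lookup path e ≡ zer
      path-e = subst (λ q → Permits q (lookup path e)) (upd-same F e none) (conforms e)
      conforms″ : Conforms F (path [ e ]≔ sgn b)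
      conforms″ g with g ≟F e
      ... | yes refl = subst (λ q → Permits q _) (sym Fe)
              (subst (λ s → Agree s b) (sym (lookup∘update g path (sgn b))) (Agree-sgn b))
      ... | no g≢e = subst (Permits (F g)) (sym (lookup∘update′ g≢e path (sgn b)))
              (subst (λ q → Permits q _) (upd-other F g≢e) (conforms g))

    cut-through : ∀ Y → Y z ≡ true → Y a ≡ false → Closed F′ Y → Through IsCut (flip ∘ F) e
    cut-through Y Yz Ya closed = D , (tabulate (not ∘ Y) , refl) ,
      (λ q → sgn-nonzero b (trans (sym D-e) q)) , conforms″
      where
      -- The complement of `Y`, since `e` enters `Y` and a cut is positive on edges that leave its
      -- defining set.
      D = cutVec G (tabulate (not ∘ Y))

      value : ∀ f → lookup D f ≡ cutSign (not (Y (tail G f))) (not (Y (head G f)))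
      value f = trans (lookup∘tabulate _ f)
        (cong₂ cutSign (lookup∘tabulate (not ∘ Y) (tail G f)) (lookup∘tabulate (not ∘ Y) (head G f)))

      crossing : ∀ b f → Y (to b f) ≡ true → Y (from b f) ≡ false → lookup D f ≡ sgn b
      crossing true f p q = trans (value f) (cong₂ (λ x y → cutSign (not x) (not y)) q p)
      crossing false f p q = trans (value f) (cong₂ (λ x y → cutSign (not x) (not y)) p q)

      D-e : lookup D e ≡ sgn b
      D-e = crossing b e Yz Ya

      -- An edge that may not be followed out of `Y` may be crossed inwards by a cut in the flipped
      -- painting; closedness of `Y` supplies the premise.
      one-way : ∀ q c → ¬ Permits q (sgn (not c)) → Permits (flip q) (sgn c)
      one-way (one true) true p = refl
      one-way (one false) true p = ⊥-elim (p refl)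
      one-way (one true) false p = ⊥-elim (p refl)
      one-way (one false) false p = refl
      one-way bi c p = ⊥-elim (p tt)
      one-way none c p = tt

      leaving : ∀ c f → Y (from c f) ≡ true → Y (to c f) ≡ false → ¬ Permits (F′ f) (sgn c)
      leaving c f p q r with trans (sym q) (closed f c r p)
      ... | ()

      allowed : ∀ f → Permits (flip (F′ f)) (lookup D f)
      allowed f with Y (tail G f) in p | Y (head G f) in q
      ... | true | true = subst (Permits (flip (F′ f)))
        (sym (trans (value f) (cong₂ (λ x y → cutSign (not x) (not y)) p q))) (permits-zer (flip (F′ f)))
      ... | false | false = subst (Permits (flip (F′ f)))
        (sym (trans (value f) (cong₂ (λ x y → cutSign (not x) (not y)) p q))) (permits-zer (flip (F′ f)))
      ... | true | false = subst (Permits (flip (F′ f))) (sym (crossing false f p q))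
        (one-way (F′ f) false (leaving true f p q))
      ... | false | true = subst (Permits (flip (F′ f))) (sym (crossing true f q p))
        (one-way (F′ f) true (leaving false f q p))

      conforms″ : Conforms (flip ∘ F) D
      conforms″ f with f ≟F e
      ... | yes refl = subst (λ q → Permits (flip q) _) (sym Fe) (subst (λ s → Agree s b) (sym D-e) (Agree-sgn b))
      ... | no f≢e = subst (λ q → Permits (flip q) _) (upd-other F f≢e) (allowed f)

    painting : Through (IsFlow G) F e ⊎ Through IsCut (flip ∘ F) e
    painting = by-source (Y a) refl
      where
      open Closure closure
      by-source : ∀ x → Y a ≡ x → Through (IsFlow G) F e ⊎ Through IsCut (flip ∘ F) e
      by-source true p = inj₁ (cycle-through (reached a p))
      by-source false p = inj₂ (cut-through Y (extends z (upd-same _ z true)) p closed)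

  flowsAndCuts : Pair (nE G)
  flowsAndCuts = record
    { Flw = IsFlow G
    ; Cut = IsCut
    ; orth = λ {C} {D} → flow-cut {C} {D}
    ; minty = λ F e Fe → Painting.painting F e Fe
    }

  -- For cycles `Elementary` unfolds to the given definition; for cocycles minimality ranges over
  -- vertex sets instead of cut vectors and has to be translated.
  cocycle⇒elementary : ∀ {D} → IsCocycle G D → Elementary IsCut D
  cocycle⇒elementary (d , D≢0 , minimal) = d , D≢0 , λ { _ (Y , refl) → minimal Y }

  elementary⇒cocycle : ∀ {D} → Elementary IsCut D → IsCocycle G D
  elementary⇒cocycle (d , D≢0 , minimal) = d , D≢0 , λ Y → minimal (cutVec G Y) (Y , refl)

  cyclesAndCocycles : Pair (nE G)
  cyclesAndCocycles = record
    { Flw = IsCycle G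
    ; Cut = IsCocycle G
    ; orth = λ {C} {D} c d → flow-cut {C} {D} (proj₁ c) (proj₁ d)
    ; minty = λ F e Fe → Sum.map₂ (λ (D , d , rest) → D , elementary⇒cocycle d , rest)
        (Pair.minty (elementary flowsAndCuts) F e Fe)
    }

-- Orientations of a graph

ι : ℤ → ℚ
ι a = mkℚ a 0 (Coprimality.sym (1-coprimeTo _))

ι-+ : ∀ a b → ι a ℚ.+ ι b ≡ ι (a + b)
ι-+ a b = ℚ.toℚᵘ-injective (ℚᵘ.≃-trans (ℚ.toℚᵘ-homo-+ (ι a) (ι b)) (ℚᵘ.*≡* (cross a b)))
  where
  cross : ∀ a b → (a * 1ℤ + b * 1ℤ) * 1ℤ ≡ (a + b) * (1ℤ * 1ℤ)
  cross = solve-∀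

combo-sumL : ∀ G (K : List (SVec G)) e → combo {G} (List.map (1ℚ ,_) K) e ≡ ι (sumL K e)
combo-sumL G [] e = refl
combo-sumL G (C ∷ K) e = trans (cong₂ ℚ._+_ (trans (ℚ.*-identityˡ _) (sgn-ι (lookup C e))) (combo-sumL G K e))
  (ι-+ (⟪ C ⟫ e) (sumL K e))
  where
  sgn-ι : ∀ s → sgnℚ s ≡ ι (sgnℤ s)
  sgn-ι plus = refl
  sgn-ι minus = refl
  sgn-ι zer = refl

-- Each list entry receives coefficient 1, so integer multiplicities are expressed by repetition.
acyclic-integral : ∀ {G} {P : SVec G → Set} {σ} → AcyclicSig G P σ → ∀ K →
  All (λ C → P C × σ C ≡ true) K → (∀ e → sumL K e ≡ 0ℤ) → K ≡ []
acyclic-integral acyc [] _ _ = refl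
acyclic-integral {G} acyc K@(_ ∷ _) good balanced with acyc (List.map (1ℚ ,_) K)
    (All.map⁺ (All.map (λ (c , p) → c , p , ℚ.positive⁻¹ 1ℚ) good))
    (λ e → trans (combo-sumL G K e) (cong ι (balanced e)))
... | ()

vec-ext : {v w : Vec A n} → (∀ i → lookup v i ≡ lookup w i) → v ≡ w
vec-ext {v = v} {w} p = trans (sym (tabulate∘lookup v)) (trans (tabulate-cong p) (tabulate∘lookup w))

fundAt-cong : ∀ {S : Sys n} {o T T′ P P′} → (∀ e → T′ e ≡ T e) → (∀ e → P′ e ≡ P e) →
  FundAt S o T P → FundAt S o T′ P′
fundAt-cong {o = o} p q fund e Te with fund e (trans (sym (p e)) Te)
... | C , c , supp , Ce≢0 , sC , agr =
  C , c , (λ f r → Sum.map₁ (trans (p f)) (supp f r)) , Ce≢0 , sC , subst (Agree _) (sym (q e)) agr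

conforms-cong : ∀ {P P′ : Fin n → Bool} → (∀ e → P′ e ≡ P e) → ∀ {C} →
  Conforms (one ∘ P) C → Conforms (one ∘ P′) C
conforms-cong p conf e = subst (Agree _) (sym (p e)) (conf e)

val-injective : ∀ {a b} → val a ≡ val b → a ≡ b
val-injective {true} {true} _ = refl
val-injective {false} {false} _ = refl
val-injective {true} {false} ()
val-injective {false} {true} ()

val-endpoint : ∀ b → ¬ (0ℚ ℚ.< val b × val b ℚ.< 1ℚ)
val-endpoint true (_ , p) = ℚ.<-irrefl refl p
val-endpoint false (p , _) = ℚ.<-irrefl refl p

module Orientations (G : Graph) (connected : Connected G)
  (σ : SVec G → Bool) (σ-sig : IsCycleSig G σ) (σ-acyclic : AcyclicSig G (IsCycle G) σ)
  (σ* : SVec G → Bool) (σ*-sig : IsCocycleSig G σ*) (σ*-acyclic : AcyclicSig G (IsCocycle G) σ*) where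
  open Boundary G

  S : Sys (nE G)
  S = record
    { pair = cyclesAndCocycles
    ; cyc? = elementary? flow?
    ; coc? = λ D → map′ elementary⇒cocycle cocycle⇒elementary (elementary? cut? D)
    ; neg-cyc = λ {C} → elementary-neg {P = IsFlow G} (λ {C} → flow-negated {C}) {C}
    ; neg-coc = elementary⇒cocycle ∘ elementary-neg {P = IsCut} (λ {D} → cut-negated {D}) ∘ cocycle⇒elementary
    ; s = σ
    ; s* = σ*
    ; sig = σ-sig
    ; sig* = σ*-sig
    ; acyclic = acyclic-integral {G} {IsCycle G} σ-acyclic
    ; acyclic* = acyclic-integral {G} {IsCocycle G} σ*-acyclic
    }

  -- Bases of compatible orientations are spanning trees

  module Tree (T : ESet G) {P : E → Bool} (fund : Fund S (lookup T) P) where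
    F : E → Paint
    F e = if lookup T e then bi else none

    F-in-T : ∀ e {b} → Permits (F e) (sgn b) → lookup T e ≡ true
    F-in-T e p with lookup T e
    ... | true = refl
    F-in-T e {true} () | false
    F-in-T e {false} () | false

    T-in-F : ∀ e b → lookup T e ≡ true → Permits (F e) (sgn b)
    T-in-F e b p rewrite p = tt

    TreeReach : V → V → Set
    TreeReach = Reach G λ e → _∈ₑ_ {G} e T

    step : ∀ u e b → Permits (F e) (sgn b) → TreeReach u (from b e) → TreeReach u (to b e)
    step u e true p r = fwd e (F-in-T e {true} p) r
    step u e false p r = bwd e (F-in-T e {false} p) r

    -- The cut of a set closed under the edges of T avoids T, so it vanishes.
    closed-constant : ∀ Y → Closed F Y → ∀ e → Y (tail G e) ≡ Y (head G e)
    closed-constant Y closed e = equal (Y (tail G e)) (Y (head G e)) (trans (sym (value e))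
      (sgnℤ-zero (flow-vanishes (dual S) {true} {lookup T} {P} (proj₁ fund)
        (flow λ C c → trans (dot-comm ⟪ D ⟫ ⟪ C ⟫) (flow-cut {C} {D} (proj₁ c) (tabulate Y , refl)))
        (λ f Tf → cong sgnℤ (trans (value f) (same f Tf))) e)))
      where
      D = cutVec G (tabulate Y)
      value : ∀ f → lookup D f ≡ cutSign (Y (tail G f)) (Y (head G f))
      value f = trans (lookup∘tabulate _ f)
        (cong₂ cutSign (lookup∘tabulate Y (tail G f)) (lookup∘tabulate Y (head G f)))
      equal : ∀ x y → cutSign x y ≡ zer → x ≡ y
      equal true true _ = refl
      equal false false _ = refl
      both : ∀ x y → (x ≡ true → y ≡ true) → (y ≡ true → x ≡ true) → cutSign x y ≡ zer
      both true true _ _ = refl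
      both false false _ _ = refl
      both true false h _ with h refl
      ... | ()
      both false true _ h with h refl
      ... | ()
      same : ∀ f → lookup T f ≡ true → cutSign (Y (tail G f)) (Y (head G f)) ≡ zer
      same f Tf = both (Y (tail G f)) (Y (head G f)) (closed f true (T-in-F f true Tf))
        (closed f false (T-in-F f false Tf))

    spread : ∀ Y {u v} → Closed F Y → Y u ≡ true → Reach G (λ _ → ⊤) u v → Y v ≡ true
    spread Y closed p here = p
    spread Y closed p (fwd e _ r) = trans (sym (closed-constant Y closed e)) (spread Y closed p r)
    spread Y closed p (bwd e _ r) = trans (closed-constant Y closed e) (spread Y closed p r)

    -- The vertices reached from `u` along `T` form a closed set, which is constant along every edge
    -- and hence everything, as the graph is connected. A cycle inside `T` is a flow vanishing
    -- outside the basis, hence zero.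
    spanning : SpanningTree G T
    spanning = reach , λ C c C⊆T → no-cycle C c C⊆T
      where
      reach : ∀ u v → TreeReach u v
      reach u v = reached v (spread Y closed (extends u (upd-same _ u true)) (connected u v))
        where
        open Grow F (λ _ → TreeReach u) (λ _ _ _ r → r) (λ _ e b p _ _ r → step u e b p r)
        only-u : ∀ w → upd (λ _ → false) u true w ≡ true → TreeReach u w
        only-u w p with w ≟F u
        only-u w () | no _
        ... | yes refl = here
        open Closure (grow _ (upd (λ _ → false) u true) ℕ.≤-refl only-u)

      no-cycle : ∀ C → IsCycle G C → ¬ (∀ e → InSupp {G} C e → _∈ₑ_ {G} e T)
      no-cycle C c@(_ , (e , Ce≢0) , _) C⊆T = Ce≢0 (sgnℤ-zero
        (flow-vanishes S {false} {lookup T} {P} (proj₂ fund) (flow-cycle S {C} c) outside e))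
        where
        outside : ∀ f → lookup T f ≡ false → ⟪ C ⟫ f ≡ 0ℤ
        outside f Tf with zer? (lookup C f)
        ... | yes p = cong sgnℤ p
        ... | no p with trans (sym Tf) (C⊆T f p)
        ... | ()

  -- The map φ and its half-open cells

  phi⇒reversal : ∀ {O X} → Phi G σ σ* O X → Reversal S (lookup O) (lookup X)
  phi⇒reversal (T , _ , P , orient , good , good* , Cs , Ds , cycles , cocycles , disjoint , O≡ , X≡) = record
    { T = lookup T
    ; P = lookup P
    ; fund = (λ e → proj₁ (orient e)) , (λ e → proj₂ (orient e))
    ; good = λ C c conf → good C (c , conf)
    ; good* = λ D d conf → good* D (d , conf)
    ; Cs = Cs
    ; Ds = Ds
    ; cycles = cycles
    ; cocycles = cocycles
    ; disjoint = disjoint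
    ; O-value = λ e → trans (cong (λ v → lookup v e) O≡) (lookup∘tabulate _ e)
    ; X-value = λ e → trans (cong (λ v → lookup v e) X≡) (lookup∘tabulate _ e)
    }

  reversal⇒phi : ∀ {O X} → Reversal S O X → Phi G σ σ* (tabulate O) (tabulate X)
  reversal⇒phi R = T′ , Tree.spanning T′ fund′ , P′ , (λ e → proj₁ fund′ e , proj₂ fund′ e) ,
    (λ C (c , conf) → good C c (conforms-cong (λ e → sym (P-lookup e)) {C} conf)) ,
    (λ D (d , conf) → good* D d (conforms-cong (λ e → sym (P-lookup e)) {D} conf)) ,
    Cs , Ds ,
    All.map (λ {C} (c , conf) → c , conforms-cong P-lookup {C} conf) cycles ,
    All.map (λ {D} (d , conf) → d , conforms-cong P-lookup {D} conf) cocycles ,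
    disjoint ,
    tabulate-cong (λ e → trans (O-value e) (cong (λ p → if union (Cs ++ Ds) e then not p else p) (sym (P-lookup e)))) ,
    tabulate-cong (λ e → trans (X-value e) (cong (λ t → (t ∨ union Cs e) ∧ not (union Ds e)) (sym (T-lookup e))))
    where
    open Reversal R
    T′ = tabulate T
    P′ = tabulate P
    T-lookup = lookup∘tabulate T
    P-lookup = lookup∘tabulate P
    fund′ : Fund S (lookup T′) (lookup P′)
    fund′ = fundAt-cong {S = S} T-lookup P-lookup (proj₁ fund) ,
      fundAt-cong {S = dual S} T-lookup P-lookup (proj₂ fund)

  defined : ∀ O → ∃ λ X → Phi G σ σ* O X
  defined O = tabulate (proj₁ ρ) , subst (λ O → Phi G σ σ* O (tabulate (proj₁ ρ))) (tabulate∘lookup O)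
    (reversal⇒phi (proj₂ ρ))
    where ρ = reversal S (lookup O)

  determined : ∀ O X X′ → Phi G σ σ* O X → Phi G σ σ* O X′ → X ≡ X′
  determined O X X′ φ φ′ = vec-ext λ e →
    proj₂ (reversal-unique S (phi⇒reversal φ) (phi⇒reversal φ′) (λ _ → inj₁ refl) e)

  in-cube : ∀ O X x → InHoc G O X x → Cube G x
  in-cube O X x h e = by-value (lookup X e) refl
    where
    endpoint : ∀ b → 0ℚ ℚ.≤ val b × val b ℚ.≤ 1ℚ
    endpoint true = ℚ.<⇒≤ (ℚ.positive⁻¹ 1ℚ) , ℚ.≤-refl
    endpoint false = ℚ.≤-refl , ℚ.<⇒≤ (ℚ.positive⁻¹ 1ℚ)
    at-endpoint : x e ≡ val (lookup O e) → 0ℚ ℚ.≤ x e × x e ℚ.≤ 1ℚ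
    at-endpoint p = subst (λ y → 0ℚ ℚ.≤ y × y ℚ.≤ 1ℚ) (sym p) (endpoint (lookup O e))
    by-value : ∀ b → lookup X e ≡ b → 0ℚ ℚ.≤ x e × x e ℚ.≤ 1ℚ
    by-value false p = at-endpoint (proj₁ (h e) p)
    by-value true p = [ at-endpoint , (λ (l , u) → ℚ.<⇒≤ l , ℚ.<⇒≤ u) ]′ (proj₂ (h e) p)

  -- A coordinate 0 or 1 prescribes the direction of its edge, an interior one prescribes membership
  -- in `X`. At the former the cell contains the point whether or not the edge lies in `X`.
  covered : ∀ x → Cube G x → ∃ λ O → ∃ λ X → Phi G σ σ* O X × InHoc G O X x
  covered x cube = tabulate O , tabulate X , reversal⇒phi reversed-by , λ e →
    (λ p → at-false e (trans (sym (lookup∘tabulate X e)) p)) ,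
    (λ _ → [ inj₁ , inj₂ ]′ (either e))
    where
    position : ∀ y → 0ℚ ℚ.≤ y × y ℚ.≤ 1ℚ → (∃ λ b → y ≡ val b) ⊎ (0ℚ ℚ.< y × y ℚ.< 1ℚ)
    position y (l , u) with y ℚ.≟ 0ℚ | y ℚ.≟ 1ℚ
    ... | yes p | _ = inj₁ (false , p)
    ... | no _ | yes p = inj₁ (true , p)
    ... | no p | no q = inj₂ (ℚ.≰⇒> (λ r → p (ℚ.≤-antisym r l)) , ℚ.≰⇒> λ r → q (ℚ.≤-antisym u r))

    pos = λ e → position (x e) (cube e)

    free : E → Bool
    free e = [ (λ _ → false) , (λ _ → true) ]′ (pos e)

    -- The value `false` at interior coordinates is a placeholder: directions are prescribed only
    -- where `free` is `false`.
    o : E → Bool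
    o e = [ proj₁ , (λ _ → false) ]′ (pos e)

    open Prescribed (prescribed S (allFin _) free o (λ _ → true) (λ e _ → ∈-allFin e))

    fixed : ∀ e → free e ≡ false → x e ≡ val (o e)
    fixed e p with pos e
    ... | inj₁ (b , q) = q

    interior : ∀ e → free e ≡ true → 0ℚ ℚ.< x e × x e ℚ.< 1ℚ
    interior e p with pos e
    ... | inj₂ q = q

    at-fixed : ∀ e → free e ≡ false → x e ≡ val (lookup (tabulate O) e)
    at-fixed e p = trans (fixed e p) (cong val (sym (trans (lookup∘tabulate O e) (outside e p))))

    either : ∀ e → x e ≡ val (lookup (tabulate O) e) ⊎ (0ℚ ℚ.< x e × x e ℚ.< 1ℚ)
    either e = by-value (free e) refl
      where
      by-value : ∀ b → free e ≡ b → x e ≡ val (lookup (tabulate O) e) ⊎ (0ℚ ℚ.< x e × x e ℚ.< 1ℚ)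
      by-value false p = inj₁ (at-fixed e p)
      by-value true p = inj₂ (interior e p)

    at-false : ∀ e → X e ≡ false → x e ≡ val (lookup (tabulate O) e)
    at-false e p = at-fixed e (¬-not λ q → not-true (trans (sym p) (inside e q)))
      where
      not-true : false ≢ true
      not-true ()

  -- Where `X` and `X′` differ, the cell whose set omits the edge forces the coordinate to be 0 or
  -- 1, and then both orientations can be read off from `x`.
  disjoint-cells : ∀ x O O′ X X′ → Phi G σ σ* O X → Phi G σ σ* O′ X′ →
    InHoc G O X x → InHoc G O′ X′ x → O ≡ O′
  disjoint-cells x O O′ X X′ φ φ′ h h′ = vec-ext λ e →
    proj₁ (reversal-unique S (phi⇒reversal φ) (phi⇒reversal φ′) agree e)
    where
    compare : ∀ e b b′ → lookup X e ≡ b → lookup X′ e ≡ b′ → lookup O e ≡ lookup O′ e ⊎ lookup X e ≡ lookup X′ e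
    compare e true true p q = inj₂ (trans p (sym q))
    compare e false false p q = inj₂ (trans p (sym q))
    compare e false true p q with proj₁ (h e) p | proj₂ (h′ e) q
    ... | r | inj₁ r′ = inj₁ (val-injective (trans (sym r) r′))
    ... | r | inj₂ r′ = ⊥-elim (val-endpoint (lookup O e) (subst (λ y → 0ℚ ℚ.< y × y ℚ.< 1ℚ) r r′))
    compare e true false p q with proj₂ (h e) p | proj₁ (h′ e) q
    ... | inj₁ r | r′ = inj₁ (val-injective (trans (sym r) r′))
    ... | inj₂ r | r′ = ⊥-elim (val-endpoint (lookup O′ e) (subst (λ y → 0ℚ ℚ.< y × y ℚ.< 1ℚ) r′ r))

    agree : ∀ e → lookup O e ≡ lookup O′ e ⊎ lookup X e ≡ lookup X′ e
    agree e = compare e (lookup X e) (lookup X′ e) refl refl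

theorem4p8 : (G : Graph) → Connected G →
    (σ : SVec G → Bool) → IsCycleSig G σ → AcyclicSig G (IsCycle G) σ →
    (σ* : SVec G → Bool) → IsCocycleSig G σ* → AcyclicSig G (IsCocycle G) σ* →
    -- φ is a well-defined map {0,1}^E → subsets of E
    ((O : Ori G) → ∃ λ S → Phi G σ σ* O S) ×
    ((O : Ori G) (S S' : ESet G) → Phi G σ σ* O S → Phi G σ σ* O S' → S ≡ S') ×
    -- each cell lies in the cube
    ((O : Ori G) (S : ESet G) (x : CtsOri G) → Phi G σ σ* O S → InHoc G O S x → Cube G x) ×
    -- every point of the cube lies in some cell hoc(O, φ(O))
    ((x : CtsOri G) → Cube G x → ∃ λ O → ∃ λ S → Phi G σ σ* O S × InHoc G O S x) ×
    -- the cells are pairwise disjoint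
    ((x : CtsOri G) (O O' : Ori G) (S S' : ESet G) → Phi G σ σ* O S → Phi G σ σ* O' S' →
      InHoc G O S x → InHoc G O' S' x → O ≡ O')
theorem4p8 G connected σ σ-sig σ-acyclic σ* σ*-sig σ*-acyclic =
  defined , determined , (λ O S x _ → in-cube O S x) , covered , disjoint-cells
  where open Orientations G connected σ σ-sig σ-acyclic σ* σ*-sig σ*-acyclic
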